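{- Let $T$ be a finite tree with vertex set $V$, $|V|\ge 2$, and with every edge carrying the label $1$. Let $(T^*,\alpha^*)$ be the generalized inverse of $T$. Then two distinct vertices $u,v\in V$ are joined by an edge $e=uv$ in $T^*$ if and only if $T$ contains a $u_Mv$ alternating path for some maximum matching $M$ of $T$, and in that case the label of $e$ is $\alpha^*(e)=\alpha^*(uv)=\mu_T(u,v)/m(T)$.
   Context: Adjacency matrix of $T$: the symmetric $(0,1)$-matrix $A$ indexed by $V$ with $uv$-th entry $1$ if $uv$ is an edge of $T$ and $0$ otherwise. Generalized inverse of a matrix: a real symmetric $n\times n$ matrix $A$ of rank $k$ can be written as $PAP^T=D$ with $P$ orthogonal and $D=\mathrm{diag}(\lambda_1,\ldots,\lambda_k,0,\ldots,0)$, where $\lambda_1,\ldots,\lambda_k$ are the non-zero eigenvalues of $A$. The generalized inverse of $A$ is $A^*=P^TD^*P$, where $D^*=\mathrm{diag}(\lambda_1^{ -1},\ldots,\lambda_k^{ -1},0,\ldots,0)$. (It coincides with the Moore–Penrose inverse of $A$.) Generalized inverse of a graph: if $A$ is the adjacency matrix of $T$, the generalized inverse of $T$ is the edge-labeled graph $(T^*,\alpha^*)$ (loops allowed) on the same vertex set $V$, in which $e=uv$ is an edge if and only if the $uv$-th entry of $A^*$ is non-zero, and then this entry is the label $\alpha^*(e)$. Matchings: a maximum matching is a matching of maximum cardinality; $m(T)$ is the total number of maximum matchings of $T$. For a matching $M$ of $T$ and distinct vertices $u,v$, a $u_Mv$ alternating path is a $u$–$v$ path in $T$ whose edges belong alternately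 to $M$ and not to $M$, such that the first and last edges (those incident to $u$ and to $v$) both belong to $M$ (a single edge of $M$ is allowed). For distinct $u,v$ at odd distance in $T$, $\sigma(u,v)=+1$ if the distance is congruent to $1$ mod $4$ and $\sigma(u,v)=-1$ if it is congruent to $-1$ mod $4$. For such a pair, $\mu_T(u,v)$ is $\sigma(u,v)$ times the number of maximum matchings $M$ of $T$ for which there exists a $u_Mv$ alternating path in $T$; otherwise (in particular if $u=v$ or the distance is even) $\mu_T(u,v)=0$. -}

module Defs where

open import Level using (_⊔_) renaming (suc to lsuc)
open import Data.Bool.Base using (Bool; true; false; T; if_then_else_)
open import Data.Bool.Properties using (T-irrelevant; T?)
open import Data.Nat.Base as ℕ using (ℕ; zero; suc; z≤n; s≤s; NonZero)
import Data.Nat.Properties as ℕ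
open import Data.Integer.Base as ℤ using (ℤ; +_; -[1+_])
open import Data.Fin.Base using (Fin; toℕ; fromℕ<) renaming (_<_ to _<ᶠ_)
open import Data.Fin.Properties as Fin using (_≟_) renaming (_<?_ to _<ᶠ?_)
open import Data.Fin.Subset using (Subset; _∈_; ⊥)
open import Data.Fin.Subset.Properties using (_∈?_; ∉⊥)
open import Data.Vec.Base as Vec using (Vec; []; _∷_; lookup)
open import Data.Vec.Properties using (lookup-replicate)
open import Data.List.Base as List using (List; []; _∷_; [_]; length; filter)
open import Data.List.Membership.Propositional using () renaming (_∈_ to _∈ˡ_)
open import Data.List.Membership.Propositional.Properties
  using (∈-cartesianProductWith⁺; ∈-filter⁺; ∈-length; ∈-lookup)
open import Data.List.Relation.Unary.Any using (here; there)
open import Data.List.Relation.Unary.All as All using ()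
open import Data.List.Relation.Unary.All.Properties using (all-filter)
open import Data.List.Relation.Unary.AllPairs using ([]; _∷_; allPairs?)
open import Data.List.Relation.Unary.Unique.Propositional using (Unique)
import Data.List.Extrema.Nat as Extrema
open import Data.Product.Base using (Σ; ∃; ∃-syntax; _×_; _,_; proj₁; proj₂)
open import Data.Sum.Base using (_⊎_; inj₁; inj₂)
open import Data.Unit.Base using (tt)
open import Function.Base using (_∘_)
open import Relation.Nullary using (¬_; Dec; yes; no; contradiction; ¬?)
open import Relation.Nullary.Decidable using (_×-dec_; _→-dec_; does; map′)
open import Relation.Unary using (Decidable)
open import Relation.Binary.Core using (Rel)
open import Relation.Binary.Structures using (IsStrictPartialOrder)
open import Relation.Binary.PropositionalEquality as ≡ using (_≡_; _≢_; refl; subst)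
open import Algebra.Bundles using (CommutativeRing; RawMonoid)
open import Algebra.Apartness.Bundles using (HeytingField)
import Algebra.Properties.Semiring.Sum
import Algebra.Properties.Ring
import Algebra.Definitions.RawMonoid
import Relation.Binary.Reasoning.Setoid

------------------------------------------------------------------------

record Graph (n : ℕ) : Set where
  field
    adj        : Fin n → Fin n → Bool
    adj-sym    : ∀ u v → adj u v ≡ adj v u
    adj-irrefl : ∀ v → adj v v ≡ false

  infix 4 _~_
  _~_ : Fin n → Fin n → Set
  u ~ v = T (adj u v)

  infixr 5 _∷_
  data Walk : Fin n → Fin n → ℕ → Set where
    []  : ∀ {v} → Walk v v 0
    _∷_ : ∀ {u v w k} → u ~ v → Walk v w k → Walk u w (suc k)

  vertices : ∀ {u v k} → Walk u v k → List (Fin n)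
  vertices {u} []      = [ u ]
  vertices {u} (e ∷ w) = u ∷ vertices w

  IsPath : ∀ {u v k} → Walk u v k → Set
  IsPath w = Unique (vertices w)

  Connected : Set
  Connected = ∀ u v → ∃[ k ] Walk u v k

  -- A cycle is a path of length at least 2 closed up by one more edge.
  Acyclic : Set
  Acyclic = ∀ {u v k} (w : Walk u v k) → IsPath w → 2 ℕ.≤ k → ¬ (v ~ u)

  record IsTree : Set where
    field
      connected : Connected
      acyclic   : Acyclic

  IsDistance : Fin n → Fin n → ℕ → Set
  IsDistance u v d = Walk u v d × (∀ {k} → Walk u v k → d ℕ.≤ k)

-- A set of (undirected) edges is stored as a symmetric relation, v ∈ lookup M u
-- meaning that uv belongs to M; symmetry is part of IsMatching.
EdgeSet : ℕ → Set
EdgeSet n = Vec (Subset n) n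

_⟨_,_⟩ : ∀ {n} → EdgeSet n → Fin n → Fin n → Set
M ⟨ u , v ⟩ = v ∈ lookup M u

_⟨_,_⟩? : ∀ {n} (M : EdgeSet n) u v → Dec (M ⟨ u , v ⟩)
M ⟨ u , v ⟩? = v ∈? lookup M u

-- Each undirected edge is counted once, in its orientation u < v.
size : ∀ {n} → EdgeSet n → ℕ
size {n} M = length (filter (λ (u , v) → (u <ᶠ? v) ×-dec (M ⟨ u , v ⟩?))
                            (List.cartesianProduct (List.allFin n) (List.allFin n)))

record IsMatching {n} (G : Graph n) (M : EdgeSet n) : Set where
  open Graph G
  field
    symmetric : ∀ u v → M ⟨ u , v ⟩ → M ⟨ v , u ⟩
    edges     : ∀ u v → M ⟨ u , v ⟩ → u ~ v
    disjoint  : ∀ u v w → M ⟨ u , v ⟩ → M ⟨ u , w ⟩ → v ≡ w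

record IsMaximumMatching {n} (G : Graph n) (M : EdgeSet n) : Set where
  field
    isMatching : IsMatching G M
    maximum    : ∀ M′ → IsMatching G M′ → size M′ ℕ.≤ size M

module _ {n} (G : Graph n) where
  open Graph G

  -- The edges of the walk lie alternately in and outside M, the first and the
  -- last ones lying in M.
  data Alternating (M : EdgeSet n) : ∀ {u v k} → Walk u v k → Set where
    single : ∀ {u v} {e : u ~ v} → M ⟨ u , v ⟩ → Alternating M (e ∷ [])
    step   : ∀ {u v w x k} {e : u ~ v} {f : v ~ w} {p : Walk w x k} →
             M ⟨ u , v ⟩ → ¬ M ⟨ v , w ⟩ → Alternating M p →
             Alternating M (e ∷ f ∷ p)

  AlternatingPath : EdgeSet n → Fin n → Fin n → Set
  AlternatingPath M u v =
    ∃[ k ] Σ (Walk u v k) λ p → IsPath p × Alternating M p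

------------------------------------------------------------------------

vectors : ∀ {A : Set} → List A → ∀ n → List (Vec A n)
vectors xs zero    = [ [] ]
vectors xs (suc n) = List.cartesianProductWith _∷_ xs (vectors xs n)

-- Every edge set exactly once.
allEdgeSets : ∀ n → List (EdgeSet n)
allEdgeSets n = vectors (vectors (true ∷ false ∷ []) n) n

count : ∀ {n} {P : EdgeSet n → Set} → Decidable P → ℕ
count {n} P? = length (filter P? (allEdgeSets n))

∈-vectors : ∀ {A : Set} {xs : List A} → (∀ x → x ∈ˡ xs) →
            ∀ {n} (v : Vec A n) → v ∈ˡ vectors xs n
∈-vectors all []      = here refl
∈-vectors all (x ∷ v) = ∈-cartesianProductWith⁺ _∷_ (all x) (∈-vectors all v)

∈-bools : ∀ b → b ∈ˡ (true ∷ false ∷ [])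
∈-bools true  = here refl
∈-bools false = there (here refl)

∈-allEdgeSets : ∀ {n} (M : EdgeSet n) → M ∈ˡ allEdgeSets n
∈-allEdgeSets = ∈-vectors (∈-vectors ∈-bools)

∀M? : ∀ {n} {P : EdgeSet n → Set} → Decidable P → Dec (∀ M → P M)
∀M? {n} P? = map′ (λ all M → All.lookup all (∈-allEdgeSets M))
                  (λ f → All.tabulate (λ {M} _ → f M))
                  (All.all? P? (allEdgeSets n))

count-nonZero : ∀ {n} {P : EdgeSet n → Set} (P? : Decidable P) →
                ∃ P → NonZero (count P?)
count-nonZero P? (M , p) = ℕ.>-nonZero (∈-length (∈-filter⁺ P? (∈-allEdgeSets M) p))

------------------------------------------------------------------------

module _ {n} (G : Graph n) where
  open Graph G

  isMatching? : Decidable (IsMatching G)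
  isMatching? M = map′
    (λ (s , e , d) → record { symmetric = s ; edges = e ; disjoint = d })
    (λ m → let open IsMatching m in symmetric , edges , disjoint)
    ( Fin.all? (λ u → Fin.all? λ v → (M ⟨ u , v ⟩?) →-dec (M ⟨ v , u ⟩?))
    ×-dec Fin.all? (λ u → Fin.all? λ v → (M ⟨ u , v ⟩?) →-dec T? (adj u v))
    ×-dec Fin.all? (λ u → Fin.all? λ v → Fin.all? λ w →
            (M ⟨ u , v ⟩?) →-dec ((M ⟨ u , w ⟩?) →-dec (v ≟ w))))

  isMaximumMatching? : Decidable (IsMaximumMatching G)
  isMaximumMatching? M = map′
    (λ (m , x) → record { isMatching = m ; maximum = x })
    (λ m → let open IsMaximumMatching m in isMatching , maximum)
    (isMatching? M ×-dec
     ∀M? (λ M′ → isMatching? M′ →-dec (size M′ ℕ.≤? size M)))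

  ∃walk? : ∀ {u v} k {P : Walk u v k → Set} → Decidable P → Dec (∃ P)
  ∃walk? {u} {v} zero P? with u ≟ v
  ... | no  u≢v  = no λ { ([] , _) → u≢v refl }
  ... | yes refl = map′ ([] ,_) (λ { ([] , p) → p }) (P? [])
  ∃walk? {u} {v} (suc k) {P} P? = map′
    (λ { (x , e , w , p) → e ∷ w , p })
    (λ { (e ∷ w , p) → _ , e , w , p })
    (Fin.any? via)
    where
    via : ∀ x → Dec (∃[ e ] ∃[ w ] P (_∷_ {v = x} e w))
    via x with T? (adj u x)
    ... | no ¬e = no λ (e , _) → ¬e e
    ... | yes e = map′ (e ,_)
      (λ { (e′ , w , p) → w , subst (λ e → P (e ∷ w)) (T-irrelevant e′ e) p })
      (∃walk? k (P? ∘ (e ∷_)))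

  isPath? : ∀ {u v k} → Decidable (IsPath {u} {v} {k})
  isPath? w = allPairs? (λ x y → ¬? (x ≟ y)) (vertices w)

  alternating? : ∀ M {u v k} → Decidable (Alternating G M {u} {v} {k})
  alternating? M [] = no λ ()
  alternating? M {u} {v} (e ∷ []) = map′ single (λ { (single p) → p }) (M ⟨ u , v ⟩?)
  alternating? M {u} (_∷_ {v = v} e (_∷_ {v = w} f p)) = map′
    (λ (a , b , c) → step a b c)
    (λ { (step a b c) → a , b , c })
    ((M ⟨ u , v ⟩?) ×-dec ¬? (M ⟨ v , w ⟩?) ×-dec alternating? M p)

  lookup-injective : ∀ {A : Set} {xs : List A} → Unique xs → ∀ i j →
                     List.lookup xs i ≡ List.lookup xs j → i ≡ j
  lookup-injective (_ ∷ _)  Fin.zero Fin.zero _ = refl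
  lookup-injective (p ∷ _)  Fin.zero (Fin.suc j) eq =
    contradiction eq (All.lookup p (∈-lookup j))
  lookup-injective (p ∷ _)  (Fin.suc i) Fin.zero eq =
    contradiction (≡.sym eq) (All.lookup p (∈-lookup i))
  lookup-injective (_ ∷ ps) (Fin.suc i) (Fin.suc j) eq =
    ≡.cong Fin.suc (lookup-injective ps i j eq)

  length-vertices : ∀ {u v k} (w : Walk u v k) → length (vertices w) ≡ suc k
  length-vertices []      = refl
  length-vertices (e ∷ w) = ≡.cong suc (length-vertices w)

  path-length : ∀ {u v k} (w : Walk u v k) → IsPath w → k ℕ.< n
  path-length w p = subst (ℕ._≤ n) (length-vertices w)
    (Fin.injective⇒≤ (λ {i} {j} → lookup-injective p i j))

  alternatingPath? : ∀ M u v → Dec (AlternatingPath G M u v)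
  alternatingPath? M u v = map′
    (λ (k , _ , w) → k , w)
    (λ (k , w , p , a) → k , path-length w p , w , p , a)
    (ℕ.anyUpTo? (λ k → ∃walk? k (λ w → isPath? w ×-dec alternating? M w)) n)

  least : ∀ {P : ℕ → Set} → Decidable P → ∀ k → P k →
          ∃[ d ] P d × (∀ {j} → P j → d ℕ.≤ j)
  least P? zero    p = 0 , p , λ _ → z≤n
  least P? (suc k) p with P? 0
  ... | yes p₀ = 0 , p₀ , λ _ → z≤n
  ... | no ¬p₀ with d , q , min ← least (P? ∘ suc) k p =
    suc d , q , λ { {zero} r → contradiction r ¬p₀ ; {suc j} r → s≤s (min r) }

  distance : Connected → ∀ u v → ∃[ d ] IsDistance u v d
  distance conn u v =
    least (λ k → map′ proj₁ (_, tt) (∃walk? k (λ _ → yes tt)))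
          (proj₁ (conn u v)) (proj₂ (conn u v))

  empty : EdgeSet n
  empty = Vec.replicate n ⊥

  empty-isMatching : IsMatching G empty
  empty-isMatching = record
    { symmetric = λ u v p → contradiction p (none u v)
    ; edges     = λ u v p → contradiction p (none u v)
    ; disjoint  = λ u v w p _ → contradiction p (none u v)
    }
    where
    none : ∀ u v → ¬ empty ⟨ u , v ⟩
    none u v p = ∉⊥ (subst (v ∈_) (lookup-replicate u ⊥) p)

  ∃maximumMatching : ∃ (IsMaximumMatching G)
  ∃maximumMatching = best , record
    { isMatching = Extrema.argmax-all size empty-isMatching
                     (all-filter isMatching? (allEdgeSets n))
    ; maximum    = λ M′ m′ → All.lookup (Extrema.f[xs]≤f[argmax] empty matchings)
                     (∈-filter⁺ isMatching? (∈-allEdgeSets M′) m′)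
    }
    where
    matchings : List (EdgeSet n)
    matchings = filter isMatching? (allEdgeSets n)
    best : EdgeSet n
    best = Extrema.argmax size empty matchings

------------------------------------------------------------------------

-- The sign for distances ≡ ±1 mod 4, and 0 for even distances.
σ : ℕ → ℤ
σ 0 = + 0
σ 1 = + 1
σ 2 = + 0
σ 3 = -[1+ 0 ]
σ (suc (suc (suc (suc d)))) = σ d

module _ {n} (G : Graph n) where

  m : ℕ
  m = count (isMaximumMatching? G)

  numAlternating : Fin n → Fin n → ℕ
  numAlternating u v =
    count (λ M → isMaximumMatching? G M ×-dec alternatingPath? G M u v)

  μ : Graph.IsTree G → Fin n → Fin n → ℤ
  μ tree u v = σ (proj₁ (distance G connected u v)) ℤ.* + numAlternating u v
    where open Graph.IsTree tree

m-nonZero : ∀ {n} (G : Graph n) → NonZero (m G)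
m-nonZero G = count-nonZero (isMaximumMatching? G) (∃maximumMatching G)

------------------------------------------------------------------------

-- The library has no real numbers, so they are axiomatised as an Archimedean,
-- Cauchy complete ordered field.  Classically ℝ is the only such field up to
-- isomorphism; constructively the Cauchy reals with moduli are one.  The
-- apartness _#_ plays the role of ≠.
record RealField c ℓ₁ ℓ₂ : Set (lsuc (c ⊔ ℓ₁ ⊔ ℓ₂)) where
  field
    heytingField : HeytingField c ℓ₁ ℓ₂
  open HeytingField heytingField public hiding (zero)

  +-rawMonoid : RawMonoid c ℓ₁
  +-rawMonoid = record { _≈_ = _≈_ ; _∙_ = _+_ ; ε = 0# }

  open Algebra.Definitions.RawMonoid +-rawMonoid public
    using () renaming (_×_ to _·_)
  infix 4 _<_
  field
    _<_                  : Rel Carrier ℓ₂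
    isStrictPartialOrder : IsStrictPartialOrder _≈_ _<_
    #⇒<⊎>                : ∀ {x y} → x # y → x < y ⊎ y < x
    <⇒#                  : ∀ {x y} → x < y → x # y
    +-monoˡ-<            : ∀ {x y} z → x < y → x + z < y + z
    *-pos                : ∀ {x y} → 0# < x → 0# < y → 0# < x * y
    archimedean          : ∀ x → ∃[ k ] x < k · 1#

  Cauchy : (ℕ → Carrier) → Set (c ⊔ ℓ₂)
  Cauchy s = ∀ ε → 0# < ε →
    ∃[ N ] ∀ i j → N ℕ.≤ i → N ℕ.≤ j → s i - s j < ε

  _⟶_ : (ℕ → Carrier) → Carrier → Set (c ⊔ ℓ₂)
  s ⟶ l = ∀ ε → 0# < ε →
    ∃[ N ] ∀ i → N ℕ.≤ i → s i - l < ε × l - s i < ε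

  field
    complete : ∀ s → Cauchy s → ∃[ l ] s ⟶ l

module OverReals {c ℓ₁ ℓ₂} (ℝ : RealField c ℓ₁ ℓ₂) where
  open RealField ℝ renaming (refl to ≈-refl; sym to ≈-sym; trans to ≈-trans)

  private
    commutativeRing : CommutativeRing c ℓ₁
    commutativeRing = record { isCommutativeRing = isCommutativeRing }
    module R = CommutativeRing commutativeRing
    module RP = Algebra.Properties.Ring R.ring
    open Algebra.Properties.Semiring.Sum R.semiring
      using (sum; sum-cong-≋; ∑-comm; *-distribˡ-sum; *-distribʳ-sum)
    module < = IsStrictPartialOrder isStrictPartialOrder

  inv : ∀ x → x # 0# → Carrier
  inv x x#0 = proj₁ (#⇒invertible x#0)

  inv-inverse : ∀ x (x#0 : x # 0#) → inv x x#0 * x ≈ 1#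
  inv-inverse x x#0 =
    ≈-trans (*-cong ≈-refl (≈-sym x-0≈x)) (proj₁ (proj₂ (#⇒invertible x#0)))
    where
    x-0≈x : x - 0# ≈ x
    x-0≈x = ≈-trans (+-cong ≈-refl RP.-0#≈0#) (+-identityʳ x)

  fromℤ : ℤ → Carrier
  fromℤ (+ k)    = k · 1#
  fromℤ -[1+ k ] = - (suc k · 1#)

  0<1 : 0# < 1#
  0<1 with #⇒<⊎> (invertible⇒# {1#} {0#} (1# , 1-0 , ≈-trans (*-comm _ 1#) 1-0))
    where
    1-0 : 1# * (1# - 0#) ≈ 1#
    1-0 = ≈-trans (*-identityˡ _) (≈-trans (+-cong ≈-refl RP.-0#≈0#) (+-identityʳ 1#))
  ... | inj₂ 0<1 = 0<1
  ... | inj₁ 1<0 = contradiction (<.trans 1<0 0<1′) (<.irrefl ≈-refl)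
    where
    0<-1 : 0# < - 1#
    0<-1 = <.<-respˡ-≈ (-‿inverseʳ 1#) (<.<-respʳ-≈ (+-identityˡ _) (+-monoˡ-< (- 1#) 1<0))
    0<1′ : 0# < 1#
    0<1′ = <.<-respʳ-≈
      (≈-trans (≈-sym (RP.-‿distribˡ-* 1# (- 1#)))
        (≈-trans (-‿cong (*-identityˡ _)) (RP.-‿involutive 1#)))
      (*-pos 0<-1 0<-1)

  0<suc·1 : ∀ k → 0# < suc k · 1#
  0<suc·1 zero    = <.<-respʳ-≈ (≈-sym (+-identityʳ 1#)) 0<1
  0<suc·1 (suc k) = <.trans (0<suc·1 k)
    (<.<-respˡ-≈ (+-identityˡ _) (+-monoˡ-< (suc k · 1#) 0<1))

  ·1#0 : ∀ k .{{_ : NonZero k}} → k · 1# # 0#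
  ·1#0 (suc k) = #-sym (<⇒# (0<suc·1 k))

  infixl 7 _/_
  _/_ : ℤ → ∀ k .{{_ : NonZero k}} → Carrier
  z / k = fromℤ z * inv (k · 1#) (·1#0 k)

  Matrix : ℕ → Set c
  Matrix n = Fin n → Fin n → Carrier

  infix 4 _≋_
  _≋_ : ∀ {n} → Matrix n → Matrix n → Set ℓ₁
  X ≋ Y = ∀ i j → X i j ≈ Y i j

  infixl 7 _⊗_
  _⊗_ : ∀ {n} → Matrix n → Matrix n → Matrix n
  (X ⊗ Y) i j = sum (λ l → X i l * Y l j)

  infix 8 _ᵀ
  _ᵀ : ∀ {n} → Matrix n → Matrix n
  (X ᵀ) i j = X j i

  diag : ∀ {n} → (Fin n → Carrier) → Matrix n
  diag d i j = if does (i ≟ j) then d i else 0#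

  I : ∀ {n} → Matrix n
  I = diag (λ _ → 1#)

  -- (a₁, …, a_k) ↦ (a₁, …, a_k, 0, …, 0)
  pad : ∀ {n k} → (Fin k → Carrier) → Fin n → Carrier
  pad {k = k} a i with toℕ i ℕ.<? k
  ... | yes i<k = a (fromℕ< i<k)
  ... | no  _   = 0#

  Orthogonal : ∀ {n} → Matrix n → Set ℓ₁
  Orthogonal P = (P ⊗ P ᵀ ≋ I) × (P ᵀ ⊗ P ≋ I)

  record Diagonalisation {n} (A : Matrix n) : Set (c ⊔ ℓ₁ ⊔ ℓ₂) where
    field
      P           : Matrix n
      orthogonal  : Orthogonal P
      k           : ℕ
      k≤n         : k ℕ.≤ n
      eigenvalue  : Fin k → Carrier
      nonzero     : ∀ i → eigenvalue i # 0#
      diagonalises : P ⊗ A ⊗ P ᵀ ≋ diag (pad eigenvalue)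

    D* : Matrix n
    D* = diag (pad (λ i → inv (eigenvalue i) (nonzero i)))

    A* : Matrix n
    A* = P ᵀ ⊗ D* ⊗ P

  diag-sym : ∀ {n} (d : Fin n → Carrier) → diag d ᵀ ≋ diag d
  diag-sym d i j with i ≟ j | j ≟ i
  ... | yes refl | yes _   = ≈-refl
  ... | yes i≡j  | no j≢i  = contradiction (≡.sym i≡j) j≢i
  ... | no i≢j   | yes j≡i = contradiction (≡.sym j≡i) i≢j
  ... | no _     | no _    = ≈-refl

  congruent-sym : ∀ {n} (P D : Matrix n) → D ᵀ ≋ D → (P ᵀ ⊗ D ⊗ P) ᵀ ≋ P ᵀ ⊗ D ⊗ P
  congruent-sym {n} P D D-sym u v = begin
    sum (λ j → sum (λ i → P i v * D i j) * P j u)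
      ≈⟨ sum-cong-≋ (λ j → *-distribʳ-sum (P j u) (λ i → P i v * D i j)) ⟩
    sum (λ j → sum (λ i → P i v * D i j * P j u))
      ≈⟨ ∑-comm (λ j i → P i v * D i j * P j u) ⟩
    sum (λ i → sum (λ j → P i v * D i j * P j u))
      ≈⟨ sum-cong-≋ (λ i → sum-cong-≋ (λ j → swap i j)) ⟩
    sum (λ i → sum (λ j → P j u * D j i * P i v))
      ≈⟨ sum-cong-≋ (λ i → *-distribʳ-sum (P i v) (λ j → P j u * D j i)) ⟨
    sum (λ i → sum (λ j → P j u * D j i) * P i v) ∎
    where
    open Relation.Binary.Reasoning.Setoid R.setoid
    swap : ∀ i j → P i v * D i j * P j u ≈ P j u * D j i * P i v
    swap i j = begin
      P i v * D i j * P j u   ≈⟨ *-comm _ _ ⟩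
      P j u * (P i v * D i j) ≈⟨ *-cong ≈-refl (*-comm _ _) ⟩
      P j u * (D i j * P i v) ≈⟨ *-assoc _ _ _ ⟨
      P j u * D i j * P i v   ≈⟨ *-cong (*-cong ≈-refl (D-sym j i)) ≈-refl ⟩
      P j u * D j i * P i v   ∎

  record LabelledGraph (n : ℕ) : Set (lsuc ℓ₂ ⊔ c ⊔ ℓ₁) where
    field
      Edge      : Fin n → Fin n → Set ℓ₂
      Edge-sym  : ∀ {u v} → Edge u v → Edge v u
      label     : ∀ {u v} → Edge u v → Carrier
      label-sym : ∀ {u v} (e : Edge u v) (e′ : Edge v u) → label e ≈ label e′

  matrixGraph : ∀ {n} (X : Matrix n) → X ᵀ ≋ X → LabelledGraph n
  matrixGraph X X-sym = record
    { Edge      = λ u v → X u v # 0#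
    ; Edge-sym  = λ {u} {v} e → invertible⇒#
        (let (y , l , r) = #⇒invertible e
             eq          = +-cong (X-sym u v) ≈-refl
         in y , ≈-trans (*-cong ≈-refl eq) l , ≈-trans (*-cong eq ≈-refl) r)
    ; label     = λ {u} {v} _ → X u v
    ; label-sym = λ {u} {v} _ _ → X-sym v u
    }

  adjacencyMatrix : ∀ {n} → Graph n → Matrix n
  adjacencyMatrix G u v = if Graph.adj G u v then 1# else 0#

  generalizedInverse : ∀ {n} (G : Graph n) → Diagonalisation (adjacencyMatrix G) →
                       LabelledGraph n
  generalizedInverse G δ = matrixGraph A* (congruent-sym P D* (diag-sym _))
    where open Diagonalisation δ

{-# OPTIONS --safe #-}
module Submission where

-- In a tree T with adjacency matrix A, the (u, v) entry of the adjugate of x I - A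
-- is φ(T - P), the characteristic polynomial of T without the path P from u to v;
-- its coefficients are signed numbers of matchings that avoid P.  Comparing the
-- coefficients of (x I - A) adj (x I - A) = φ(T) I around the lowest power of x in
-- φ(T), which combinatorially is a vertex deletion recurrence for matchings, gives
-- A B = I - Z, A Z = 0 and B = A Y for symmetric matrices B and Z, where
-- m(T) B(u, v) is up to sign the number of matchings avoiding P that become maximum
-- when every other edge of P is added, that is μ(u, v).  Hence A B = B A, A B A = A
-- and B A B = B.  Diagonalising A, the generalized inverse A* satisfies the same
-- three equations, and these have at most one solution.

open import Defs
open import Algebra.Bundles using (Monoid; CommutativeRing)
import Algebra.Properties.CommutativeSemigroup
import Algebra.Properties.Ring
import Algebra.Properties.Semiring.Mult
import Algebra.Properties.Semiring.Sum
open import Data.Bool.Base using (true; false; T; if_then_else_; _xor_)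
import Data.Bool.Properties as Bool
open import Data.Empty using (⊥)
open import Data.Fin.Base as Fin using (Fin; zero; suc; toℕ) renaming (_<_ to _<ᶠ_)
import Data.Fin.Properties as Fin
open import Data.Integer.Base as ℤ using (ℤ; +_; -[1+_])
import Data.Integer.Properties as ℤ
open import Data.List.Base as List using (List; []; _∷_; length; filter; _++_)
import Data.List.Properties as List
open import Data.List.Membership.Propositional using (_∈_; _∉_)
open import Data.List.Membership.Propositional.Properties
  using (∈-filter⁺; ∈-filter⁻; ∈-cartesianProduct⁺; ∈-allFin; ∈-map⁺; ∈-map⁻)
open import Data.List.Membership.Propositional.Properties.WithK using (unique∧set⇒bag)
open import Data.List.Relation.Binary.BagAndSetEquality using (∼bag⇒↭)
open import Data.List.Relation.Binary.Permutation.Propositional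
  using (_↭_; ↭-refl; ↭-sym; ↭-trans; ↭-swap; ↭-prep; ↭-reflexive; ↭⇒↭ₛ; module PermutationReasoning)
open import Data.List.Relation.Binary.Permutation.Propositional.Properties
  using (All-resp-↭; ∈-resp-↭; ↭-length; shift)
import Data.List.Relation.Binary.Permutation.Setoid.Properties as ↭ₛ
open import Data.List.Relation.Binary.Subset.Propositional using (_⊆_)
open import Data.List.Relation.Unary.All as All using (All; []; _∷_)
open import Data.List.Relation.Unary.All.Properties using (All¬⇒¬Any; ¬Any⇒All¬; ++⁻ˡ; ++⁻ʳ)
open import Data.List.Relation.Unary.AllPairs using ([]; _∷_)
open import Data.List.Relation.Unary.Any as Any using (here; there)
open import Data.List.Relation.Unary.Unique.Propositional using (Unique)
import Data.List.Relation.Unary.Unique.Propositional.Properties as Unique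
open import Data.Nat.Base as ℕ using (ℕ; zero; suc; NonZero; _≤_)
import Data.Nat.Properties as ℕ
open import Data.Product.Base using (Σ; ∃; ∃-syntax; _×_; _,_; proj₁; proj₂)
open import Data.Sum.Base using (_⊎_; inj₁; inj₂)
open import Data.Unit.Base using (⊤; tt)
open import Data.Vec.Base using (_∷_; lookup; tabulate)
import Data.Vec.Properties as Vec
open import Function.Base using (_∘_; id)
open import Function.Bundles using (_⇔_; mk⇔; Equivalence)
open import Relation.Binary.Definitions using (tri<; tri≈; tri>)
open import Relation.Binary.PropositionalEquality as ≡ using (_≡_; _≢_)
import Relation.Binary.Reasoning.Setoid
open import Relation.Nullary using (¬_; ¬?; Dec; yes; no; does; contradiction; _×-dec_; _⊎-dec_)
open import Relation.Nullary.Decidable using (dec-true; dec-false; map′)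
open import Relation.Unary using (Decidable)

-- No polynomial is formed. The power x ^ (n - ℓ) is remembered by ℓ alone, the number of vertices
-- covered by a matching or lying on P, and comparing coefficients becomes one recurrence, `A⊗W`,
-- that links layer ℓ to layer ℓ + 1. It is used around K = 2ν, where ν is the size of a maximum
-- matching. At layer K its right-hand side is m(T) I, which gives A B + Z = I. At the layers K - 1
-- and K + 1 it is 0, because a tree is bipartite and φ(T) lacks every second power. Layer K - 1
-- therefore writes B as A Y. At K + 1 there remains a term from layer K + 2; it vanishes because a
-- matching avoiding P, enlarged by every other edge of P, would have ν + 1 edges. This gives A Z =
-- 0. The factorisation settles what B does on the kernel of A, which A B A = A and A B = B A leave
-- open. Commutation replaces the symmetry of A B and B A in the Moore-Penrose equations, so that
-- uniqueness and the passage to diagonal matrices are computations in a monoid.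

module ℕΣ = Algebra.Properties.Semiring.Sum ℕ.+-*-semiring

module Matchings where
  open import Relation.Binary.PropositionalEquality
  open import Data.Nat.Base using (_+_; _*_)
  open ℕΣ using (sum; sum-cong-≗; ∑-distrib-+; sum-replicate-zero)

  -- Counting edge sets by bijection and by cases

  length-unique-≡ : ∀ {a} {A : Set a} {xs ys : List A} → Unique xs → Unique ys →
                    (∀ {x} → x ∈ xs ⇔ x ∈ ys) → length xs ≡ length ys
  length-unique-≡ xs! ys! eq = ↭-length (∼bag⇒↭ (unique∧set⇒bag xs! ys! eq))

  vectors-unique : ∀ {A : Set} {xs : List A} → Unique xs → ∀ n → Unique (vectors xs n)
  vectors-unique xs! zero    = [] ∷ []
  vectors-unique xs! (suc n) =
    Unique.cartesianProductWith⁺ _∷_ Vec.∷-injective xs! (vectors-unique xs! n)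

  allEdgeSets-unique : ∀ n → Unique (allEdgeSets n)
  allEdgeSets-unique n =
    vectors-unique (vectors-unique (((λ ()) ∷ []) ∷ [] ∷ []) n) n

  module _ {n} {P Q : EdgeSet n → Set} (P? : Decidable P) (Q? : Decidable Q) where

    -- Stated for involutions because, besides the identity, the only bijection used is the toggling
    -- of one edge, which is its own inverse; injectivity and surjectivity both come from `f²`.
    count-involution : (f : EdgeSet n → EdgeSet n) → (∀ M → f (f M) ≡ M) →
                       (∀ {M} → P M → Q (f M)) → (∀ {M} → Q M → P (f M)) →
                       count P? ≡ count Q?
    count-involution f f² P⇒Q Q⇒P = begin
      length (filter P? all)              ≡⟨ List.length-map f (filter P? all) ⟨
      length (List.map f (filter P? all)) ≡⟨ length-unique-≡
        (Unique.map⁺ f-injective (Unique.filter⁺ P? (allEdgeSets-unique n)))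
        (Unique.filter⁺ Q? (allEdgeSets-unique n)) (mk⇔ to from) ⟩
      length (filter Q? all)              ∎
      where
      open ≡-Reasoning
      all : List (EdgeSet n)
      all = allEdgeSets n
      f-injective : ∀ {x y} → f x ≡ f y → x ≡ y
      f-injective {x} {y} eq = trans (sym (f² x)) (trans (cong f eq) (f² y))
      to : ∀ {M} → M ∈ List.map f (filter P? all) → M ∈ filter Q? all
      to M∈ with M , M∈ , refl ← ∈-map⁻ f M∈ =
        ∈-filter⁺ Q? (∈-allEdgeSets _) (P⇒Q (proj₂ (∈-filter⁻ P? {xs = all} M∈)))
      from : ∀ {M} → M ∈ filter Q? all → M ∈ List.map f (filter P? all)
      from {M} M∈ = subst (_∈ List.map f (filter P? all)) (f² M)
        (∈-map⁺ f (∈-filter⁺ P? (∈-allEdgeSets _) (Q⇒P (proj₂ (∈-filter⁻ Q? {xs = all} M∈)))))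

    count-cong : (∀ {M} → P M → Q M) → (∀ {M} → Q M → P M) → count P? ≡ count Q?
    count-cong = count-involution id (λ _ → refl)

  count-empty : ∀ {n} {P : EdgeSet n → Set} (P? : Decidable P) → (∀ M → ¬ P M) → count P? ≡ 0
  count-empty {n} P? ¬P =
    cong length (List.filter-none P? (All.tabulate {xs = allEdgeSets n} (λ {M} _ → ¬P M)))

  count-witness : ∀ {n} {P : EdgeSet n → Set} (P? : Decidable P) → count P? ≢ 0 → ∃ P
  count-witness {n} P? ≢0 with filter P? (allEdgeSets n) in eq
  ... | []     = contradiction refl ≢0
  ... | M ∷ Ms = M , proj₂ (∈-filter⁻ P? {xs = allEdgeSets n} (subst (M ∈_) (sym eq) (here refl)))

  indicator : ∀ {p} {P : Set p} → Dec P → ℕ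
  indicator P? = if does P? then 1 else 0

  indicator-yes : ∀ {p} {P : Set p} (P? : Dec P) → P → indicator P? ≡ 1
  indicator-yes (yes _) _ = refl
  indicator-yes (no ¬p) p = contradiction p ¬p

  indicator-no : ∀ {p} {P : Set p} (P? : Dec P) → ¬ P → indicator P? ≡ 0
  indicator-no (yes p) ¬p = contradiction p ¬p
  indicator-no (no _)  _  = refl

  sum-zero : ∀ {n} (f : Fin n → ℕ) → (∀ i → f i ≡ 0) → sum f ≡ 0
  sum-zero {n} f f≡0 = trans (sum-cong-≗ f≡0) (sum-replicate-zero n)

  sum-single : ∀ {n} (f : Fin n → ℕ) i → (∀ j → j ≢ i → f j ≡ 0) → sum f ≡ f i
  sum-single f zero    f≡0 =
    trans (cong (f zero ℕ.+_) (sum-zero (f ∘ suc) (λ j → f≡0 (suc j) λ ()))) (ℕ.+-identityʳ _)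
  sum-single f (suc i) f≡0 = cong₂ _+_ (f≡0 zero λ ())
    (sum-single (f ∘ suc) i (λ j j≢i → f≡0 (suc j) (j≢i ∘ Fin.suc-injective)))

  module _ {a} {A : Set a} where

    length-filter-∷ : ∀ {p} {P : A → Set p} (P? : Decidable P) x xs →
      length (filter P? (x ∷ xs)) ≡ indicator (P? x) + length (filter P? xs)
    length-filter-∷ P? x xs with does (P? x)
    ... | true  = refl
    ... | false = refl

    -- An identity between indicators expresses at once that the cases are disjoint and exhaustive,
    -- and it can be added up element by element.
    length-filter-partition : ∀ {p q r k} {P : A → Set p} {Q : A → Set q} {R : Fin k → A → Set r}
      (P? : Decidable P) (Q? : Decidable Q) (R? : ∀ w → Decidable (R w)) →
      (∀ x → indicator (P? x) ≡ indicator (Q? x) + sum (λ w → indicator (R? w x))) →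
      ∀ xs → length (filter P? xs) ≡ length (filter Q? xs) + sum (λ w → length (filter (R? w) xs))
    length-filter-partition {k = k} P? Q? R? split []       = sym (sum-replicate-zero k)
    length-filter-partition P? Q? R? split (x ∷ xs) = begin
      length (filter P? (x ∷ xs))
        ≡⟨ length-filter-∷ P? x xs ⟩
      indicator (P? x) + length (filter P? xs)
        ≡⟨ cong₂ _+_ (split x) (length-filter-partition P? Q? R? split xs) ⟩
      (indicator (Q? x) + sum (λ w → indicator (R? w x))) +
      (length (filter Q? xs) + sum (λ w → length (filter (R? w) xs)))
        ≡⟨ +-interchange (indicator (Q? x)) _ _ _ ⟩
      (indicator (Q? x) + length (filter Q? xs)) +
      (sum (λ w → indicator (R? w x)) + sum (λ w → length (filter (R? w) xs)))
        ≡⟨ cong₂ _+_ (length-filter-∷ Q? x xs)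
             (∑-distrib-+ (λ w → indicator (R? w x)) (λ w → length (filter (R? w) xs))) ⟨
      length (filter Q? (x ∷ xs)) + sum (λ w → indicator (R? w x) + length (filter (R? w) xs))
        ≡⟨ cong (length (filter Q? (x ∷ xs)) ℕ.+_) (sum-cong-≗ (λ w → length-filter-∷ (R? w) x xs)) ⟨
      length (filter Q? (x ∷ xs)) + sum (λ w → length (filter (R? w) (x ∷ xs))) ∎
      where
      open ≡-Reasoning
      open import Algebra.Properties.CommutativeSemigroup ℕ.+-commutativeSemigroup
        using () renaming (interchange to +-interchange)

  -- Toggling one edge

  Joins : ∀ {n} (x y i j : Fin n) → Set
  Joins x y i j = i ≡ x × j ≡ y ⊎ i ≡ y × j ≡ x

  joins? : ∀ {n} (x y i j : Fin n) → Dec (Joins x y i j)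
  joins? x y i j = (i Fin.≟ x) ×-dec (j Fin.≟ y) ⊎-dec (i Fin.≟ y) ×-dec (j Fin.≟ x)

  Joins-sym : ∀ {n} {x y i j : Fin n} → Joins x y i j → Joins x y j i
  Joins-sym (inj₁ (p , q)) = inj₂ (q , p)
  Joins-sym (inj₂ (p , q)) = inj₁ (q , p)

  module _ {n} (x y : Fin n) where

    -- Both orientations of xy are flipped, since an edge set stores both. Insertion and deletion
    -- become the same map, hence an involution.
    toggle : EdgeSet n → EdgeSet n
    toggle M = tabulate λ i → tabulate λ j → does (joins? x y i j) xor lookup (lookup M i) j

    lookup-toggle : ∀ M i j → lookup (lookup (toggle M) i) j ≡
                              does (joins? x y i j) xor lookup (lookup M i) j
    lookup-toggle M i j = trans (cong (λ r → lookup r j) (Vec.lookup∘tabulate _ i))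
                                (Vec.lookup∘tabulate _ j)

    toggle-involutive : ∀ M → toggle (toggle M) ≡ M
    toggle-involutive M = begin
      toggle (toggle M)
        ≡⟨ Vec.tabulate-cong (λ i → Vec.tabulate-cong (λ j → twice i j)) ⟩
      tabulate (λ i → tabulate (lookup (lookup M i)))
        ≡⟨ Vec.tabulate-cong (λ i → Vec.tabulate∘lookup (lookup M i)) ⟩
      tabulate (lookup M)
        ≡⟨ Vec.tabulate∘lookup M ⟩
      M ∎
      where
      open ≡-Reasoning
      twice : ∀ i j → does (joins? x y i j) xor lookup (lookup (toggle M) i) j ≡ lookup (lookup M i) j
      twice i j = begin
        b xor lookup (lookup (toggle M) i) j  ≡⟨ cong (b xor_) (lookup-toggle M i j) ⟩
        b xor (b xor lookup (lookup M i) j)   ≡⟨ Bool.xor-assoc b b _ ⟨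
        (b xor b) xor lookup (lookup M i) j   ≡⟨ cong (_xor lookup (lookup M i) j) (Bool.xor-same b) ⟩
        lookup (lookup M i) j                 ∎
        where b = does (joins? x y i j)

    module _ (M : EdgeSet n) {i j : Fin n} where

      toggle-unjoined : ¬ Joins x y i j → toggle M ⟨ i , j ⟩ ⇔ M ⟨ i , j ⟩
      toggle-unjoined ¬J = mk⇔
        (λ p → Vec.lookup⇒[]= j _ (trans (sym unchanged) (Vec.[]=⇒lookup p)))
        (λ p → Vec.lookup⇒[]= j _ (trans unchanged (Vec.[]=⇒lookup p)))
        where
        unchanged : lookup (lookup (toggle M) i) j ≡ lookup (lookup M i) j
        unchanged = trans (lookup-toggle M i j)
          (cong (_xor lookup (lookup M i) j) (dec-false (joins? x y i j) ¬J))

      toggle-joined : Joins x y i j → ¬ M ⟨ i , j ⟩ → toggle M ⟨ i , j ⟩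
      toggle-joined J ¬p = Vec.lookup⇒[]= j _ (trans (lookup-toggle M i j)
        (cong₂ _xor_ (dec-true (joins? x y i j) J)
          (Bool.¬-not (λ eq → ¬p (Vec.lookup⇒[]= j _ eq)))))

      toggle-joined⁻ : Joins x y i j → M ⟨ i , j ⟩ → ¬ toggle M ⟨ i , j ⟩
      toggle-joined⁻ J p q with () ← trans (sym (Vec.[]=⇒lookup q)) (trans (lookup-toggle M i j)
        (cong₂ _xor_ (dec-true (joins? x y i j) J) (Vec.[]=⇒lookup p)))

      toggle-shrinks : (∀ {i j} → Joins x y i j → M ⟨ i , j ⟩) →
                       toggle M ⟨ i , j ⟩ → ¬ Joins x y i j × M ⟨ i , j ⟩
      toggle-shrinks xy∈M p with joins? x y i j
      ... | yes J = contradiction p (toggle-joined⁻ J (xy∈M J))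
      ... | no ¬J = ¬J , Equivalence.to (toggle-unjoined ¬J) p

    -- `size` counts an edge only in its increasing orientation. The pair (a, b) is whichever of (x,
    -- y) and (y, x) that is, so exactly one entry is added to the counted list.
    size-toggle-joined : ∀ M {a b} → a <ᶠ b → Joins x y a b →
      (∀ {i j} → Joins x y i j → i <ᶠ j → (i , j) ≡ (a , b)) →
      ¬ M ⟨ a , b ⟩ → size (toggle M) ≡ suc (size M)
    size-toggle-joined M {a} {b} a<b J unique ab∉M =
      length-unique-≡ (Unique.filter⁺ _ pairs!)
        (All.tabulate (λ { ij∈ refl → ab∉M (proj₂ (proj₂ (∈-filter⁻ _ {xs = pairs} ij∈))) }) ∷
         Unique.filter⁺ _ pairs!)
        (mk⇔ to from)
      where
      pairs : List (Fin n × Fin n)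
      pairs = List.cartesianProduct (List.allFin n) (List.allFin n)
      pairs! : Unique pairs
      pairs! = Unique.cartesianProduct⁺ (Unique.allFin⁺ n) (Unique.allFin⁺ n)
      edges : EdgeSet n → List (Fin n × Fin n)
      edges M = filter (λ (u , v) → (u Fin.<? v) ×-dec (M ⟨ u , v ⟩?)) pairs
      ∈-edges : ∀ M {i j} → i <ᶠ j → M ⟨ i , j ⟩ → (i , j) ∈ edges M
      ∈-edges M i<j p = ∈-filter⁺ _ (∈-cartesianProduct⁺ (∈-allFin _) (∈-allFin _)) (i<j , p)
      to : ∀ {e} → e ∈ edges (toggle M) → e ∈ (a , b) ∷ edges M
      to {i , j} e∈ with i<j , p ← proj₂ (∈-filter⁻ _ {xs = pairs} e∈) | joins? x y i j
      ... | yes J′ = here (unique J′ i<j)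
      ... | no ¬J  = there (∈-edges M i<j (Equivalence.to (toggle-unjoined M ¬J) p))
      from : ∀ {e} → e ∈ (a , b) ∷ edges M → e ∈ edges (toggle M)
      from (here refl) = ∈-edges (toggle M) a<b (toggle-joined M J ab∉M)
      from {i , j} (there e∈) with i<j , p ← proj₂ (∈-filter⁻ _ {xs = pairs} e∈) | joins? x y i j
      ... | no ¬J  = ∈-edges (toggle M) i<j (Equivalence.from (toggle-unjoined M ¬J) p)
      ... | yes J′ with refl ← unique J′ i<j = contradiction p ab∉M

    size-toggle-insert : ∀ M → x ≢ y → ¬ M ⟨ x , y ⟩ → ¬ M ⟨ y , x ⟩ →
                         size (toggle M) ≡ suc (size M)
    size-toggle-insert M x≢y xy∉M yx∉M with Fin.<-cmp x y
    ... | tri≈ _ x≡y _ = contradiction x≡y x≢y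
    ... | tri< x<y _ ¬y<x = size-toggle-joined M x<y (inj₁ (refl , refl))
      (λ { (inj₁ (refl , refl)) _ → refl ; (inj₂ (refl , refl)) y<x → contradiction y<x ¬y<x }) xy∉M
    ... | tri> ¬x<y _ y<x = size-toggle-joined M y<x (inj₂ (refl , refl))
      (λ { (inj₁ (refl , refl)) x<y → contradiction x<y ¬x<y ; (inj₂ (refl , refl)) _ → refl }) yx∉M

    size-toggle-delete : ∀ M → x ≢ y → M ⟨ x , y ⟩ → M ⟨ y , x ⟩ →
                         size M ≡ suc (size (toggle M))
    size-toggle-delete M x≢y xy∈M yx∈M =
      trans (cong size (sym (toggle-involutive M)))
        (size-toggle-insert (toggle M) x≢y (toggle-joined⁻ M (inj₁ (refl , refl)) xy∈M)
                                (toggle-joined⁻ M (inj₂ (refl , refl)) yx∈M))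

  -- Matchings with exposed vertices and prescribed edges

  -- On the vertices of a path the pairs are its first, third, fifth, ... edges. With M as the
  -- relation this is the alternation condition; with adjacency it only says that the path has odd
  -- length.
  Paired : ∀ {a} {A : Set a} → (A → A → Set) → List A → Set
  Paired _~_ []          = ⊤
  Paired _~_ (x ∷ [])    = ⊥
  Paired _~_ (x ∷ y ∷ R) = x ~ y × Paired _~_ R

  paired? : ∀ {a} {A : Set a} {_~_ : A → A → Set} → (∀ x y → Dec (x ~ y)) → Decidable (Paired _~_)
  paired? ~? []          = yes tt
  paired? ~? (x ∷ [])    = no λ ()
  paired? ~? (x ∷ y ∷ R) = ~? x y ×-dec paired? ~? R

  Paired-map : ∀ {a} {A : Set a} {_~₁_ _~₂_ : A → A → Set} R →
               (∀ {x y} → x ∈ R → y ∈ R → x ~₁ y → x ~₂ y) → Paired _~₁_ R → Paired _~₂_ R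
  Paired-map []          f _       = tt
  Paired-map (x ∷ y ∷ R) f (p , q) =
    f (here refl) (there (here refl)) p ,
    Paired-map R (λ x∈ y∈ → f (there (there x∈)) (there (there y∈))) q

  Exposed : ∀ {n} → EdgeSet n → Fin n → Set
  Exposed M x = ∀ y → ¬ M ⟨ x , y ⟩

  exposed? : ∀ {n} (M : EdgeSet n) → Decidable (Exposed M)
  exposed? M x = Fin.all? (λ y → ¬? (M ⟨ x , y ⟩?))

  Unique-resp-↭ : ∀ {a} {A : Set a} {xs ys : List A} → xs ↭ ys → Unique xs → Unique ys
  Unique-resp-↭ xs↭ys = ↭ₛ.Unique-resp-↭ (setoid _) (↭⇒↭ₛ xs↭ys)

  module _ {n} (G : Graph n) where
    open Graph G
    open import Data.List.Membership.DecPropositional (Fin._≟_ {n}) using (_∈?_)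

    -- Counting the vertices that are covered by M or lie in S, instead of the
    -- edges of M, avoids subtraction when edges are traded for vertices of S.
    record Config (ℓ : ℕ) (S R : List (Fin n)) (M : EdgeSet n) : Set where
      constructor config
      field
        matching : IsMatching G M
        exposed  : All (Exposed M) S
        total    : 2 * size M + length S ≡ ℓ
        paired   : Paired (M ⟨_,_⟩) R

    abstract
      config? : ∀ ℓ S R → Decidable (Config ℓ S R)
      config? ℓ S R M = map′ (λ (a , b , c , d) → config a b c d) (λ (config a b c d) → a , b , c , d)
        (isMatching? G M ×-dec All.all? (exposed? M) S ×-dec
         (2 * size M + length S ℕ.≟ ℓ) ×-dec paired? (M ⟨_,_⟩?) R)

    -- If R is empty and S has no repetitions, this is the number of matchings of G - S with (ℓ -
    -- |S|) / 2 edges; for a forest that is, up to sign, the coefficient of x ^ (n - ℓ) in the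
    -- characteristic polynomial of G - S.
    #config : ℕ → List (Fin n) → List (Fin n) → ℕ
    #config ℓ S R = count (config? ℓ S R)

    #config-↭ : ∀ ℓ {S S′} R → S ↭ S′ → #config ℓ S R ≡ #config ℓ S′ R
    #config-↭ ℓ {S} {S′} R S↭S′ = count-cong (config? ℓ S R) (config? ℓ S′ R) (go S↭S′) (go (↭-sym S↭S′))
      where
      go : ∀ {S S′ M} → S ↭ S′ → Config ℓ S R M → Config ℓ S′ R M
      go {M = M} S↭S′ (config mat exp tot pair) = config mat (All-resp-↭ S↭S′ exp)
        (trans (cong (2 * size M ℕ.+_) (sym (↭-length S↭S′))) tot) pair

    adj⇒≢ : ∀ {x y} → x ~ y → x ≢ y
    adj⇒≢ x~x refl = subst T (adj-irrefl _) x~x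

    ~-sym : ∀ {x y} → x ~ y → y ~ x
    ~-sym {x} {y} = subst T (adj-sym x y)

    module _ {x y} (x~y : x ~ y) {S R : List (Fin n)}
             (x∉S : x ∉ S) (y∉S : y ∉ S) (x∉R : x ∉ R) (y∉R : y ∉ R) where

      private
        Joins-~ : ∀ {i j} → Joins x y i j → i ~ j
        Joins-~ (inj₁ (refl , refl)) = x~y
        Joins-~ (inj₂ (refl , refl)) = ~-sym x~y

        Joins-functional : ∀ {i j k} → Joins x y i j → Joins x y i k → j ≡ k
        Joins-functional (inj₁ (_ , refl)) (inj₁ (_ , refl)) = refl
        Joins-functional (inj₂ (_ , refl)) (inj₂ (_ , refl)) = refl
        Joins-functional (inj₁ (refl , refl)) (inj₂ (refl , refl)) = refl
        Joins-functional (inj₂ (refl , refl)) (inj₁ (refl , refl)) = refl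

        ¬Joins : ∀ {L i j} → x ∉ L → y ∉ L → i ∈ L → ¬ Joins x y i j
        ¬Joins x∉L y∉L i∈L (inj₁ (refl , _)) = x∉L i∈L
        ¬Joins x∉L y∉L i∈L (inj₂ (refl , _)) = y∉L i∈L

        2*suc+ : ∀ s l → 2 * suc s + l ≡ 2 * s + suc (suc l)
        2*suc+ s l = begin
          2 * suc s + l        ≡⟨ cong (ℕ._+ l) (ℕ.*-suc 2 s) ⟩
          suc (suc (2 * s + l)) ≡⟨ cong suc (ℕ.+-suc (2 * s) l) ⟨
          suc (2 * s + suc l)   ≡⟨ ℕ.+-suc (2 * s) (suc l) ⟨
          2 * s + suc (suc l)   ∎
          where open ≡-Reasoning

        delete : ∀ {ℓ M} → Config ℓ S (x ∷ y ∷ R) M → Config ℓ (x ∷ y ∷ S) R (toggle x y M)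
        delete {ℓ} {M} (config mat exp tot (xy∈M , pair)) = config mat′ exp′ tot′ pair′
          where
          open IsMatching mat
          yx∈M : M ⟨ y , x ⟩
          yx∈M = symmetric x y xy∈M
          J⇒M : ∀ {i j} → Joins x y i j → M ⟨ i , j ⟩
          J⇒M (inj₁ (refl , refl)) = xy∈M
          J⇒M (inj₂ (refl , refl)) = yx∈M
          shrinks : ∀ i j → toggle x y M ⟨ i , j ⟩ → ¬ Joins x y i j × M ⟨ i , j ⟩
          shrinks i j = toggle-shrinks x y M J⇒M
          mat′ : IsMatching G (toggle x y M)
          mat′ = record
            { symmetric = λ u v p → let ¬J , q = shrinks u v p in
                Equivalence.from (toggle-unjoined x y M (¬J ∘ Joins-sym)) (symmetric u v q)
            ; edges     = λ u v p → edges u v (proj₂ (shrinks u v p))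
            ; disjoint  = λ u v w p q → disjoint u v w (proj₂ (shrinks u v p)) (proj₂ (shrinks u w q))
            }
          exp′ : All (Exposed (toggle x y M)) (x ∷ y ∷ S)
          exp′ = (λ j p → let ¬J , q = shrinks x j p in
                          ¬J (inj₁ (refl , disjoint x j y q xy∈M)))
               ∷ (λ j p → let ¬J , q = shrinks y j p in
                          ¬J (inj₂ (refl , disjoint y j x q yx∈M)))
               ∷ All.map (λ {i} ex j p → ex j (proj₂ (shrinks i j p))) exp
          tot′ : 2 * size (toggle x y M) + length (x ∷ y ∷ S) ≡ ℓ
          tot′ = trans (sym (2*suc+ (size (toggle x y M)) (length S)))
            (trans (cong (λ s → 2 * s + length S) (sym (size-toggle-delete x y M (adj⇒≢ x~y) xy∈M yx∈M))) tot)
          pair′ : Paired (toggle x y M ⟨_,_⟩) R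
          pair′ = Paired-map R (λ i∈R _ → Equivalence.from
            (toggle-unjoined x y M (¬Joins x∉R y∉R i∈R))) pair

        insert : ∀ {ℓ M} → Config ℓ (x ∷ y ∷ S) R M → Config ℓ S (x ∷ y ∷ R) (toggle x y M)
        insert {ℓ} {M} (config mat (x-exp ∷ y-exp ∷ exp) tot pair) = config mat′ exp′ tot′
          (toggle-joined x y M (inj₁ (refl , refl)) (x-exp y) , pair′)
          where
          open IsMatching mat
          J⇒¬M : ∀ {i j k} → Joins x y i j → ¬ M ⟨ i , k ⟩
          J⇒¬M (inj₁ (refl , _)) = x-exp _
          J⇒¬M (inj₂ (refl , _)) = y-exp _
          cases : ∀ i j → toggle x y M ⟨ i , j ⟩ → Joins x y i j ⊎ M ⟨ i , j ⟩
          cases i j p with joins? x y i j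
          ... | yes J = inj₁ J
          ... | no ¬J = inj₂ (Equivalence.to (toggle-unjoined x y M ¬J) p)
          mat′ : IsMatching G (toggle x y M)
          IsMatching.symmetric mat′ u v p with cases u v p
          ... | inj₁ J = toggle-joined x y M (Joins-sym J) (J⇒¬M (Joins-sym J))
          ... | inj₂ q = Equivalence.from
            (toggle-unjoined x y M (λ J → J⇒¬M J (symmetric u v q))) (symmetric u v q)
          IsMatching.edges mat′ u v p with cases u v p
          ... | inj₁ J = Joins-~ J
          ... | inj₂ q = edges u v q
          IsMatching.disjoint mat′ u v w p q with cases u v p | cases u w q
          ... | inj₁ J | inj₁ J′ = Joins-functional J J′
          ... | inj₁ J | inj₂ q′ = contradiction q′ (J⇒¬M J)
          ... | inj₂ p′ | inj₁ J = contradiction p′ (J⇒¬M J)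
          ... | inj₂ p′ | inj₂ q′ = disjoint u v w p′ q′
          exp′ : All (Exposed (toggle x y M)) S
          exp′ = All.tabulate λ {i} i∈S j p → All.lookup exp i∈S j
            (Equivalence.to (toggle-unjoined x y M (¬Joins x∉S y∉S i∈S)) p)
          tot′ : 2 * size (toggle x y M) + length S ≡ ℓ
          tot′ = trans (cong (λ s → 2 * s + length S) (size-toggle-insert x y M (adj⇒≢ x~y) (x-exp y) (y-exp x)))
            (trans (2*suc+ (size M) (length S)) tot)
          pair′ : Paired (toggle x y M ⟨_,_⟩) R
          pair′ = Paired-map R (λ i∈R _ → Equivalence.from
            (toggle-unjoined x y M (¬Joins x∉R y∉R i∈R))) pair

      -- Deleting xy leaves both ends exposed: the matching loses one edge, S gains two vertices,
      -- and ℓ stays the same. Conversely, exposed adjacent vertices can be joined. As x and y lie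
      -- outside S and R, the remaining conditions do not see the change.
      #config-toggle : ∀ ℓ → #config ℓ S (x ∷ y ∷ R) ≡ #config ℓ (x ∷ y ∷ S) R
      #config-toggle ℓ = count-involution (config? ℓ S (x ∷ y ∷ R)) (config? ℓ (x ∷ y ∷ S) R)
        (toggle x y) (toggle-involutive x y) delete insert

    -- For R the vertices of a path of odd length, this passes from matchings containing every other
    -- edge of the path, as in the definition of μ, to matchings avoiding the path, as in the
    -- coefficients.
    #config-paired : ∀ ℓ R {S} → Paired _~_ R → Unique (R ++ S) →
                     #config ℓ S R ≡ #config ℓ (R ++ S) []
    #config-paired ℓ []          _           _ = refl
    #config-paired ℓ (x ∷ y ∷ R) {S} (x~y , R~) ((x≢y ∷ x∉) ∷ y∉ ∷ RS!) = begin
      #config ℓ S (x ∷ y ∷ R)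
        ≡⟨ #config-toggle x~y (∉S x∉) (∉S y∉) (∉R x∉) (∉R y∉) ℓ ⟩
      #config ℓ (x ∷ y ∷ S) R
        ≡⟨ #config-paired ℓ R R~ (Unique-resp-↭ (↭-sym R++xyS) ((x≢y ∷ x∉) ∷ y∉ ∷ RS!)) ⟩
      #config ℓ (R ++ x ∷ y ∷ S) []
        ≡⟨ #config-↭ ℓ [] R++xyS ⟩
      #config ℓ (x ∷ y ∷ R ++ S) [] ∎
      where
      open ≡-Reasoning
      R++xyS : R ++ x ∷ y ∷ S ↭ x ∷ y ∷ R ++ S
      R++xyS = ↭-trans (shift x R (y ∷ S)) (↭-prep x (shift y R S))
      ∉S : ∀ {z} → All (z ≢_) (R ++ S) → z ∉ S
      ∉S z∉ = All¬⇒¬Any (++⁻ʳ R z∉)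
      ∉R : ∀ {z} → All (z ≢_) (R ++ S) → z ∉ R
      ∉R z∉ = All¬⇒¬Any (++⁻ˡ R z∉)

    abstract
      extends? : ∀ S x w → Dec (x ~ w × w ∉ S)
      extends? S x w = Bool.T? (adj x w) ×-dec ¬? (w ∈? S)

    extensions : ℕ → List (Fin n) → Fin n → Fin n → ℕ
    extensions ℓ S x w = if does (extends? S x w) then #config ℓ (w ∷ x ∷ S) [] else 0

    extensions-yes : ∀ ℓ {S x w} → x ~ w → w ∉ S → extensions ℓ S x w ≡ #config ℓ (w ∷ x ∷ S) []
    extensions-yes ℓ {S} {x} {w} x~w w∉S =
      cong (if_then #config ℓ (w ∷ x ∷ S) [] else 0) (dec-true (extends? S x w) (x~w , w∉S))

    extensions-no : ∀ ℓ {S x w} → ¬ (x ~ w × w ∉ S) → extensions ℓ S x w ≡ 0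
    extensions-no ℓ {S} {x} {w} ¬ext =
      cong (if_then #config ℓ (w ∷ x ∷ S) [] else 0) (dec-false (extends? S x w) ¬ext)

    -- A matching either exposes x, and moving x into S raises ℓ by one, or contains exactly one
    -- edge xw, which is traded for its ends at the same ℓ. In coefficients this is the recurrence
    -- φ(H) = t φ(H - x) - Σ φ(H - x - w) for the matching polynomial of H = G - S in the variable
    -- t, with the signs left out.
    #config-deletion : ∀ ℓ {x S} → x ∉ S →
      #config ℓ S [] ≡ #config (suc ℓ) (x ∷ S) [] + sum (extensions ℓ S x)
    #config-deletion ℓ {x} {S} x∉S = begin
      #config ℓ S []
        ≡⟨ length-filter-partition (config? ℓ S []) (config? (suc ℓ) (x ∷ S) [])
             (λ w → config? ℓ S (x ∷ w ∷ [])) split (allEdgeSets n) ⟩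
      #config (suc ℓ) (x ∷ S) [] + sum (λ w → #config ℓ S (x ∷ w ∷ []))
        ≡⟨ cong (#config (suc ℓ) (x ∷ S) [] ℕ.+_) (sum-cong-≗ matched) ⟩
      #config (suc ℓ) (x ∷ S) [] + sum (extensions ℓ S x) ∎
      where
      open ≡-Reasoning
      matchedTo : EdgeSet n → Fin n → ℕ
      matchedTo M w = indicator (config? ℓ S (x ∷ w ∷ []) M)
      split : ∀ M → indicator (config? ℓ S [] M) ≡
        indicator (config? (suc ℓ) (x ∷ S) [] M) + sum (matchedTo M)
      split M with config? ℓ S [] M
      ... | no ¬c = sym (cong₂ _+_
        (indicator-no (config? (suc ℓ) (x ∷ S) [] M)
          (λ { (config a (_ ∷ b) c d) → ¬c (config a b (ℕ.suc-injective (trans (sym (ℕ.+-suc _ _)) c)) d) }))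
        (sum-zero (matchedTo M) (λ w → indicator-no (config? ℓ S (x ∷ w ∷ []) M)
          (λ (config a b c _) → ¬c (config a b c tt)))))
      ... | yes (config a b c d) with Fin.any? (λ w → M ⟨ x , w ⟩?)
      ...   | yes (w , xw∈M) = sym (cong₂ _+_
        (indicator-no (config? (suc ℓ) (x ∷ S) [] M)
          (λ { (config _ (x-exp ∷ _) _ _) → x-exp w xw∈M }))
        (trans (sum-single (matchedTo M) w (λ w′ w′≢w → indicator-no (config? ℓ S (x ∷ w′ ∷ []) M)
                  (λ (config _ _ _ (xw′∈M , _)) → w′≢w (IsMatching.disjoint a x w′ w xw′∈M xw∈M))))
               (indicator-yes (config? ℓ S (x ∷ w ∷ []) M) (config a b c (xw∈M , tt)))))
      ...   | no x-exp = sym (cong₂ _+_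
        (indicator-yes (config? (suc ℓ) (x ∷ S) [] M)
          (config a ((λ w p → x-exp (w , p)) ∷ b) (trans (ℕ.+-suc _ _) (cong suc c)) d))
        (sum-zero (matchedTo M) (λ w → indicator-no (config? ℓ S (x ∷ w ∷ []) M)
          (λ (config _ _ _ (p , _)) → x-exp (w , p)))))
      matched : ∀ w → #config ℓ S (x ∷ w ∷ []) ≡ extensions ℓ S x w
      matched w with Bool.T? (adj x w) | w ∈? S
      ... | no ¬x~w | _ = trans
        (count-empty (config? ℓ S (x ∷ w ∷ []))
          (λ M (config a _ _ (p , _)) → ¬x~w (IsMatching.edges a x w p)))
        (sym (extensions-no ℓ (¬x~w ∘ proj₁)))
      ... | yes x~w | yes w∈S = trans
        (count-empty (config? ℓ S (x ∷ w ∷ []))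
          (λ M (config a b _ (p , _)) → All.lookup b w∈S x (IsMatching.symmetric a x w p)))
        (sym (extensions-no ℓ (λ (_ , w∉S) → w∉S w∈S)))
      ... | yes x~w | no w∉S = begin
        #config ℓ S (x ∷ w ∷ [])   ≡⟨ #config-toggle x~w x∉S w∉S (λ ()) (λ ()) ℓ ⟩
        #config ℓ (x ∷ w ∷ S) []   ≡⟨ #config-↭ ℓ [] (↭-swap x w ↭-refl) ⟩
        #config ℓ (w ∷ x ∷ S) []   ≡⟨ extensions-yes ℓ x~w w∉S ⟨
        extensions ℓ S x w         ∎

  -- Signs and parity of lengths

  σ-+2 : ∀ k → σ (2 + k) ≡ ℤ.- σ k
  σ-+2 0 = refl
  σ-+2 1 = refl
  σ-+2 2 = refl
  σ-+2 3 = refl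
  σ-+2 (suc (suc (suc (suc k)))) = σ-+2 k

  -- Oddness is needed only to invert the sign of an entry, so it is encoded by the two invertible
  -- values of σ.
  Odd : ℕ → Set
  Odd k = σ k ≡ + 1 ⊎ σ k ≡ -[1+ 0 ]

  Odd-+2 : ∀ k → Odd k → Odd (2 + k)
  Odd-+2 k (inj₁ eq) = inj₂ (trans (σ-+2 k) (cong ℤ.-_ eq))
  Odd-+2 k (inj₂ eq) = inj₁ (trans (σ-+2 k) (cong ℤ.-_ eq))

  -- Walks, paths and their uniqueness

  module _ {n} (G : Graph n) where
    open Graph G

    IsPath-∷ : ∀ {u v w k} (e : u ~ v) (p : Walk v w k) → IsPath p → u ∉ vertices p → IsPath (e ∷ p)
    IsPath-∷ _ _ p! u∉p = ¬Any⇒All¬ _ u∉p ∷ p!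

    source-∈ : ∀ {u v k} (p : Walk u v k) → u ∈ vertices p
    source-∈ []      = here refl
    source-∈ (e ∷ p) = here refl

    target-∈ : ∀ {u v k} (p : Walk u v k) → v ∈ vertices p
    target-∈ []      = here refl
    target-∈ (e ∷ p) = there (target-∈ p)

    source-unique : ∀ {u v u′ v′ k k′} (p : Walk u v k) (q : Walk u′ v′ k′) →
                    vertices p ≡ vertices q → u ≡ u′
    source-unique []      []      = List.∷-injectiveˡ
    source-unique []      (_ ∷ _) = List.∷-injectiveˡ
    source-unique (_ ∷ _) []      = List.∷-injectiveˡ
    source-unique (_ ∷ _) (_ ∷ _) = List.∷-injectiveˡ

    length-unique : ∀ {u v u′ v′ k k′} (p : Walk u v k) (q : Walk u′ v′ k′) →
                    vertices p ≡ vertices q → k ≡ k′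
    length-unique p q eq = ℕ.suc-injective
      (trans (sym (length-vertices G p)) (trans (cong length eq) (length-vertices G q)))

    infixr 5 _++ʷ_
    _++ʷ_ : ∀ {u v w k l} → Walk u v k → Walk v w l → Walk u w (k + l)
    []      ++ʷ q = q
    (e ∷ p) ++ʷ q = e ∷ p ++ʷ q

    vertices-++ʷ : ∀ {u v w k l} (p : Walk u v k) (q : Walk v w l) {x} →
                   x ∈ vertices (p ++ʷ q) → x ∈ vertices p ⊎ x ∈ vertices q
    vertices-++ʷ []      q x∈         = inj₂ x∈
    vertices-++ʷ (e ∷ p) q (here eq)  = inj₁ (here eq)
    vertices-++ʷ (e ∷ p) q (there x∈) with vertices-++ʷ p q x∈
    ... | inj₁ x∈p = inj₁ (there x∈p)
    ... | inj₂ x∈q = inj₂ x∈q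

    infixl 5 _∷ʳ_
    _∷ʳ_ : ∀ {u v w k} → Walk u v k → v ~ w → Walk u w (suc k)
    []      ∷ʳ e = e ∷ []
    (f ∷ p) ∷ʳ e = f ∷ (p ∷ʳ e)

    reverse : ∀ {u v k} → Walk u v k → Walk v u k
    reverse []      = []
    reverse (e ∷ p) = reverse p ∷ʳ ~-sym G e

    vertices-∷ʳ : ∀ {u v w k} (p : Walk u v k) (e : v ~ w) → vertices (p ∷ʳ e) ≡ vertices p ++ w ∷ []
    vertices-∷ʳ []      e = refl
    vertices-∷ʳ (f ∷ p) e = cong (_ ∷_) (vertices-∷ʳ p e)

    vertices-reverse : ∀ {u v k} (p : Walk u v k) → vertices (reverse p) ↭ vertices p
    vertices-reverse []          = ↭-refl
    vertices-reverse {u} (e ∷ p) = begin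
      vertices (reverse p ∷ʳ ~-sym G e)  ≡⟨ vertices-∷ʳ (reverse p) (~-sym G e) ⟩
      vertices (reverse p) ++ u ∷ []     ↭⟨ shift u (vertices (reverse p)) [] ⟩
      u ∷ vertices (reverse p) ++ []     ≡⟨ cong (u ∷_) (List.++-identityʳ _) ⟩
      u ∷ vertices (reverse p)           ↭⟨ ↭-prep u (vertices-reverse p) ⟩
      u ∷ vertices p                     ∎
      where open PermutationReasoning

    -- The last condition lets the path be extended wherever the walk can be.
    PathWithin : ∀ {u v k} → Walk u v k → Fin n → Set
    PathWithin {v = v} {k} p u =
      ∃[ l ] l ℕ.≤ k × Σ (Walk u v l) λ q → IsPath q × vertices q ⊆ vertices p

    truncate : ∀ {u v w k} (p : Walk u v k) → IsPath p → w ∈ vertices p → PathWithin p w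
    truncate []      p! (here refl) = 0 , ℕ.z≤n , [] , p! , id
    truncate (e ∷ p) p! (here refl) = _ , ℕ.≤-refl , e ∷ p , p! , id
    truncate (e ∷ p) (_ ∷ p!) (there w∈) with l , l≤k , q , q! , q⊆ ← truncate p p! w∈ =
      l , ℕ.m≤n⇒m≤1+n l≤k , q , q! , there ∘ q⊆

    toPath : ∀ {u v k} (p : Walk u v k) → PathWithin p u
    toPath []          = 0 , ℕ.z≤n , [] , [] ∷ [] , id
    toPath {u} (e ∷ p) with toPath p
    ... | l , l≤k , q , q! , q⊆ with Any.any? (u Fin.≟_) (vertices q)
    ...   | no u∉q  = suc l , ℕ.s≤s l≤k , e ∷ q , IsPath-∷ e q q! u∉q ,
                      λ { (here eq) → here eq ; (there x∈) → there (q⊆ x∈) }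
    ...   | yes u∈q with l′ , l′≤l , r , r! , r⊆ ← truncate q q! u∈q =
      l′ , ℕ.m≤n⇒m≤1+n (ℕ.≤-trans l′≤l l≤k) , r , r! , there ∘ q⊆ ∘ r⊆

    -- Two paths that part after u close up to a cycle through u.
    path-unique : Acyclic → ∀ {u v k l} (p : Walk u v k) (q : Walk u v l) →
                  IsPath p → IsPath q → vertices p ≡ vertices q
    path-unique acyclic []      []      _          _          = refl
    path-unique acyclic []      (f ∷ q) _          (u∉q ∷ _)  = contradiction (target-∈ q) (All¬⇒¬Any u∉q)
    path-unique acyclic (e ∷ p) []      (u∉p ∷ _)  _          = contradiction (target-∈ p) (All¬⇒¬Any u∉p)
    path-unique acyclic {u} (_∷_ {v = a} e p) (_∷_ {v = b} f q) (u∉p ∷ p!) (u∉q ∷ q!) with a Fin.≟ b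
    ... | yes refl = cong (u ∷_) (path-unique acyclic p q p! q!)
    ... | no a≢b with toPath (p ++ʷ reverse q)
    ...   | zero  , _ , []  , _  , _  = contradiction refl a≢b
    ...   | suc l , _ , r   , r! , r⊆ =
      contradiction (~-sym G f) (acyclic (e ∷ r) (IsPath-∷ e r r! u∉r) (ℕ.s≤s (ℕ.s≤s ℕ.z≤n)))
      where
      u∉r : u ∉ vertices r
      u∉r u∈ with vertices-++ʷ p (reverse q) (r⊆ u∈)
      ... | inj₁ u∈p = All¬⇒¬Any u∉p u∈p
      ... | inj₂ u∈q = All¬⇒¬Any u∉q (∈-resp-↭ (vertices-reverse q) u∈q)

  -- Alternating paths as paired vertex lists

  module _ {n} (G : Graph n) where
    open Graph G

    alternating⇒paired : ∀ {M u v k} {p : Walk u v k} → Alternating G M p →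
                         Paired (M ⟨_,_⟩) (vertices p)
    alternating⇒paired (single uv)     = uv , tt
    alternating⇒paired (step uv _ alt) = uv , alternating⇒paired alt

    -- The edges in between avoid M automatically: v is already matched to u, so vw in M would force
    -- w = u, and u does not recur on a path.
    paired⇒alternating : ∀ {M} → IsMatching G M → ∀ {u v k} (p : Walk u v k) → IsPath p →
                         Paired (M ⟨_,_⟩) (vertices p) → Alternating G M p
    paired⇒alternating mat (e ∷ [])    p! (uv , _) = single uv
    paired⇒alternating mat (_∷_ {u} {v} e (_∷_ {w = w} f p)) (u∉ ∷ _ ∷ p!) (uv , pair) =
      step uv (λ vw → All.lookup u∉ (there (source-∈ G p)) (disjoint v u _ (symmetric u v uv) vw))
        (paired⇒alternating mat p p! pair)
      where open IsMatching mat

    alternating⇒odd : ∀ {M u v k} {p : Walk u v k} → Alternating G M p → Odd k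
    alternating⇒odd (single _)     = inj₁ refl
    alternating⇒odd {k = suc (suc k)} (step _ _ alt) = Odd-+2 k (alternating⇒odd alt)

    -- Where an entry carries σ of the distance, up to a factor -1, even length makes it vanish. Its
    -- count then has to be understood only for paths whose vertices pair off.
    paired-or-even : ∀ {u v k} (p : Walk u v k) → Paired _~_ (vertices p) ⊎ σ k ≡ + 0
    paired-or-even []          = inj₂ refl
    paired-or-even (e ∷ [])    = inj₁ (e , tt)
    paired-or-even {k = suc (suc k)} (e ∷ f ∷ p) with paired-or-even p
    ... | inj₁ pair = inj₁ (e , pair)
    ... | inj₂ eq   = inj₂ (trans (σ-+2 k) (cong ℤ.-_ eq))

  -- The path between two vertices of a tree

  module TreePaths {n} (G : Graph n) (tree : Graph.IsTree G) where
    open Graph G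
    open IsTree tree

    abstract
      dist : Fin n → Fin n → ℕ
      dist u v = proj₁ (toPath G (proj₂ (connected u v)))

      path : ∀ u v → Walk u v (dist u v)
      path u v = proj₁ (proj₂ (proj₂ (toPath G (proj₂ (connected u v)))))

      path! : ∀ u v → IsPath (path u v)
      path! u v = proj₁ (proj₂ (proj₂ (proj₂ (toPath G (proj₂ (connected u v))))))

    between : Fin n → Fin n → List (Fin n)
    between u v = vertices (path u v)

    between-unique : ∀ {u v k} (p : Walk u v k) → IsPath p → between u v ≡ vertices p
    between-unique p p! = path-unique G acyclic (path _ _) p (path! _ _) p!

    dist-unique : ∀ {u v k} (p : Walk u v k) → IsPath p → dist u v ≡ k
    dist-unique p p! = length-unique G (path _ _) p (between-unique p p!)

    -- A shortest walk reduces to a path that is no longer, and the tree has only one path to offer;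
    -- so its length is the distance used by `μ`.
    dist≡distance : ∀ u v → dist u v ≡ proj₁ (distance G connected u v)
    dist≡distance u v with d , p , minimal ← distance G connected u v
      with l , l≤d , q , q! , _ ← toPath G p =
      ℕ.≤-antisym (subst (ℕ._≤ d) (sym (dist-unique q q!)) l≤d) (minimal (path u v))

    between-refl : ∀ v → between v v ≡ v ∷ []
    between-refl v = between-unique [] ([] ∷ [])

    dist-refl : ∀ v → dist v v ≡ 0
    dist-refl v = dist-unique [] ([] ∷ [])

    between-sym : ∀ u v → between u v ↭ between v u
    between-sym u v = ↭-trans
      (↭-reflexive (between-unique (reverse G (path v u))
        (Unique-resp-↭ (↭-sym (vertices-reverse G (path v u))) (path! v u))))
      (vertices-reverse G (path v u))

    dist-sym : ∀ u v → dist u v ≡ dist v u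
    dist-sym u v = ℕ.suc-injective (begin
      suc (dist u v)        ≡⟨ length-vertices G (path u v) ⟨
      length (between u v)  ≡⟨ ↭-length (between-sym u v) ⟩
      length (between v u)  ≡⟨ length-vertices G (path v u) ⟩
      suc (dist v u)        ∎)
      where open ≡-Reasoning

    between-extend : ∀ {u v w} → w ~ u → w ∉ between u v →
                     between w v ≡ w ∷ between u v × dist w v ≡ suc (dist u v)
    between-extend {u} {v} w~u w∉ = between-unique (w~u ∷ path u v) w! , dist-unique (w~u ∷ path u v) w!
      where w! = IsPath-∷ G w~u (path u v) (path! u v) w∉

    -- The neighbours of u split into `next`, which shortens the path to v, and all others, which
    -- prolong it. A second neighbour of u on the rest of the path would close a cycle;
    -- `next-unique` excludes it.
    record FirstStep (u v : Fin n) : Set where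
      field
        next          : Fin n
        adjacent      : u ~ next
        between-next  : between u v ≡ u ∷ between next v
        dist-next     : dist u v ≡ suc (dist next v)
        source-∉      : u ∉ between next v
        next-unique   : ∀ {w} → u ~ w → w ∈ between next v → w ≡ next

    firstStep : ∀ {u v} → u ≢ v → FirstStep u v
    firstStep {u} {v} u≢v with dist u v | path u v | path! u v
    ... | zero  | []    | _  = contradiction refl u≢v
    ... | suc k | _∷_ {v = x} e p | u∉p ∷ p! = record
      { next         = x
      ; adjacent     = e
      ; between-next = trans (between-unique (e ∷ p) (u∉p ∷ p!)) (cong (u ∷_) (sym (between-unique p p!)))
      ; dist-next    = trans (dist-unique (e ∷ p) (u∉p ∷ p!)) (cong suc (sym (dist-unique p p!)))
      ; source-∉     = u∉
      -- Joining the rest of the path at w gives another path from u to v, and by uniqueness both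
      -- have the same second vertex.
      ; next-unique  = λ {w} u~w w∈ →
          let _ , _ , q , q! , q⊆ = truncate G (path x v) (path! x v) w∈ in
          source-unique G q (path x v) (List.∷-injectiveʳ (path-unique G acyclic (u~w ∷ q) (e ∷ path x v)
            (IsPath-∷ G u~w q q! (u∉ ∘ q⊆)) (IsPath-∷ G e (path x v) (path! x v) u∉)))
      }
      where
      u∉ : u ∉ between x v
      u∉ u∈ = All¬⇒¬Any u∉p (subst (u ∈_) (between-unique p p!) u∈)

    alternatingPath⇔paired : ∀ {M} → IsMatching G M → ∀ u v →
      AlternatingPath G M u v ⇔ Paired (M ⟨_,_⟩) (between u v)
    alternatingPath⇔paired {M} mat u v = mk⇔
      (λ (k , p , p! , alt) →
         subst (Paired (M ⟨_,_⟩)) (sym (between-unique p p!)) (alternating⇒paired G alt))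
      (λ pair → _ , path u v , path! u v , paired⇒alternating G mat (path u v) (path! u v) pair)

  -- Maximum matchings as the top layer of configurations

  module MaximumMatchings {n} (G : Graph n) where
    open Graph G

    abstract
      ν : ℕ
      ν = size (proj₁ (∃maximumMatching G))

      size≤ν : ∀ {M} → IsMatching G M → size M ℕ.≤ ν
      size≤ν {M} = IsMaximumMatching.maximum (proj₂ (∃maximumMatching G)) M

      maximum⇒size≡ν : ∀ {M} → IsMaximumMatching G M → size M ≡ ν
      maximum⇒size≡ν {M} max = ℕ.≤-antisym (size≤ν isMatching)
        (maximum _ (IsMaximumMatching.isMatching (proj₂ (∃maximumMatching G))))
        where open IsMaximumMatching max

    maximum⇒config : ∀ {M R} → IsMaximumMatching G M → Paired (M ⟨_,_⟩) R → Config G (2 * ν) [] R M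
    maximum⇒config max = config (IsMaximumMatching.isMatching max) []
      (trans (ℕ.+-identityʳ _) (cong (2 *_) (maximum⇒size≡ν max)))

    config⇒maximum : ∀ {M R} → Config G (2 * ν) [] R M → IsMaximumMatching G M
    config⇒maximum (config mat _ total _) = record
      { isMatching = mat
      ; maximum    = λ M′ mat′ → subst (size M′ ℕ.≤_)
          (sym (ℕ.*-cancelˡ-≡ _ _ 2 (trans (sym (ℕ.+-identityʳ _)) total))) (size≤ν mat′)
      }

    m≡#config : m G ≡ #config G (2 * ν) [] []
    m≡#config = count-cong (isMaximumMatching? G) (config? G (2 * ν) [] [])
      (λ max → maximum⇒config max tt) config⇒maximum

    #config-paired-[] : ∀ ℓ {R} → Paired _~_ R → Unique R → #config G ℓ [] R ≡ #config G ℓ R []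
    #config-paired-[] ℓ {R} R~ R! = begin
      #config G ℓ [] R          ≡⟨ #config-paired G ℓ R R~ (subst Unique (sym (List.++-identityʳ R)) R!) ⟩
      #config G ℓ (R ++ []) []  ≡⟨ cong (λ S → #config G ℓ S []) (List.++-identityʳ R) ⟩
      #config G ℓ R []          ∎
      where open ≡-Reasoning

    -- A matching that exposes R can be enlarged by the pairs of R. The result has ℓ / 2 edges, more
    -- than the maximum ν allows.
    #config-beyond : ∀ {ℓ R} → 2 * ν ℕ.< ℓ → Paired _~_ R → Unique R → #config G ℓ R [] ≡ 0
    #config-beyond {ℓ} {R} 2ν<ℓ R~ R! = trans (sym (#config-paired-[] ℓ R~ R!))
      (count-empty (config? G ℓ [] R) (λ M (config mat _ total _) → ℕ.<⇒≱ 2ν<ℓ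
        (subst (ℕ._≤ 2 * ν) (trans (sym (ℕ.+-identityʳ _)) total) (ℕ.*-monoʳ-≤ 2 (size≤ν mat)))))

    #config-0-∷ : ∀ x S → #config G 0 (x ∷ S) [] ≡ 0
    #config-0-∷ x S = count-empty (config? G 0 (x ∷ S) [])
      (λ M (config _ _ total _) → ℕ.1+n≢0 (trans (sym (ℕ.+-suc (2 * size M) (length S))) total))

    module _ (tree : IsTree) where
      open TreePaths G tree

      -- An alternating path can only be the path of the tree, so its existence says that M contains
      -- every other edge of that path; these edges are then traded for their ends.
      numAlternating≡#config : ∀ {u v} → Paired _~_ (between u v) →
                               numAlternating G u v ≡ #config G (2 * ν) (between u v) []
      numAlternating≡#config {u} {v} pair = trans
        (count-cong (λ M → isMaximumMatching? G M ×-dec alternatingPath? G M u v)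
                    (config? G (2 * ν) [] (between u v))
          (λ (max , alt) → maximum⇒config max
            (Equivalence.to (alternatingPath⇔paired (IsMaximumMatching.isMatching max) u v) alt))
          (λ c → config⇒maximum c ,
            Equivalence.from (alternatingPath⇔paired (Config.matching c) u v) (Config.paired c)))
        (#config-paired-[] (2 * ν) pair (path! u v))

-- Group inverses in a monoid

module GroupInverse {c ℓ} (M : Monoid c ℓ) where
  open Monoid M
  open Relation.Binary.Reasoning.Setoid setoid

  -- For a symmetric matrix the Moore-Penrose inverse satisfies these equations. They involve no
  -- transpose and are preserved by conjugation.
  record IsGroupInverse (a x : Carrier) : Set ℓ where
    field
      a∙x∙a : a ∙ x ∙ a ≈ a
      x∙a∙x : x ∙ a ∙ x ≈ x
      comm  : a ∙ x ≈ x ∙ a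
  open IsGroupInverse

  -- The idempotent belonging to a does not depend on the inverse: `a ∙ y ∙ a ∙ x` collapses to
  -- `a ∙ x` and, after commuting both factors, to `y ∙ a`.
  unique : ∀ {a x y} → IsGroupInverse a x → IsGroupInverse a y → x ≈ y
  unique {a} {x} {y} X Y = begin
    x              ≈⟨ x∙a∙x X ⟨
    x ∙ a ∙ x      ≈⟨ assoc x a x ⟩
    x ∙ (a ∙ x)    ≈⟨ ∙-congˡ ax≈ya ⟩
    x ∙ (y ∙ a)    ≈⟨ ∙-congˡ (comm Y) ⟨
    x ∙ (a ∙ y)    ≈⟨ assoc x a y ⟨
    x ∙ a ∙ y      ≈⟨ ∙-congʳ (comm X) ⟨
    a ∙ x ∙ y      ≈⟨ ∙-congʳ ax≈ya ⟩
    y ∙ a ∙ y      ≈⟨ x∙a∙x Y ⟩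
    y              ∎
    where
    ax≈ya : a ∙ x ≈ y ∙ a
    ax≈ya = begin
      a ∙ x                ≈⟨ ∙-congʳ (a∙x∙a Y) ⟨
      a ∙ y ∙ a ∙ x        ≈⟨ assoc (a ∙ y) a x ⟩
      a ∙ y ∙ (a ∙ x)      ≈⟨ ∙-cong (comm Y) (comm X) ⟩
      y ∙ a ∙ (x ∙ a)      ≈⟨ assoc y a (x ∙ a) ⟩
      y ∙ (a ∙ (x ∙ a))    ≈⟨ ∙-congˡ (assoc a x a) ⟨
      y ∙ (a ∙ x ∙ a)      ≈⟨ ∙-congˡ (a∙x∙a X) ⟩
      y ∙ a                ∎

  respˡ : ∀ {a b x} → a ≈ b → IsGroupInverse a x → IsGroupInverse b x
  respˡ a≈b X = record
    { a∙x∙a = trans (∙-cong (∙-congʳ (sym a≈b)) (sym a≈b)) (trans (a∙x∙a X) a≈b)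
    ; x∙a∙x = trans (∙-congʳ (∙-congˡ (sym a≈b))) (x∙a∙x X)
    ; comm  = trans (∙-congʳ (sym a≈b)) (trans (comm X) (∙-congˡ a≈b))
    }

  module _ {p q} (p∙q≈ε : p ∙ q ≈ ε) (q∙p≈ε : q ∙ p ≈ ε) where

    conjugate-∙ : ∀ x y → (q ∙ x ∙ p) ∙ (q ∙ y ∙ p) ≈ q ∙ (x ∙ y) ∙ p
    conjugate-∙ x y = begin
      (q ∙ x ∙ p) ∙ (q ∙ y ∙ p)    ≈⟨ assoc (q ∙ x) p _ ⟩
      q ∙ x ∙ (p ∙ (q ∙ y ∙ p))    ≈⟨ ∙-congˡ (∙-congˡ (assoc q y p)) ⟩
      q ∙ x ∙ (p ∙ (q ∙ (y ∙ p)))  ≈⟨ ∙-congˡ (assoc p q (y ∙ p)) ⟨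
      q ∙ x ∙ (p ∙ q ∙ (y ∙ p))    ≈⟨ ∙-congˡ (trans (∙-congʳ p∙q≈ε) (identityˡ _)) ⟩
      q ∙ x ∙ (y ∙ p)              ≈⟨ assoc (q ∙ x) y p ⟨
      q ∙ x ∙ y ∙ p                ≈⟨ ∙-congʳ (assoc q x y) ⟩
      q ∙ (x ∙ y) ∙ p              ∎

    conjugate : ∀ {a x} → IsGroupInverse a x → IsGroupInverse (q ∙ a ∙ p) (q ∙ x ∙ p)
    conjugate {a} {x} X = record
      { a∙x∙a = triple (a∙x∙a X)
      ; x∙a∙x = triple (x∙a∙x X)
      ; comm  = trans (conjugate-∙ a x)
                  (trans (∙-congʳ (∙-congˡ (comm X))) (sym (conjugate-∙ x a)))
      }
      where
      triple : ∀ {x y z} → x ∙ y ∙ x ≈ z → (q ∙ x ∙ p) ∙ (q ∙ y ∙ p) ∙ (q ∙ x ∙ p) ≈ q ∙ z ∙ p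
      triple {x} {y} eq = trans (∙-congʳ (conjugate-∙ x y))
        (trans (conjugate-∙ (x ∙ y) x) (∙-congʳ (∙-congˡ eq)))

    unconjugate : ∀ {a d} → p ∙ a ∙ q ≈ d → q ∙ d ∙ p ≈ a
    unconjugate {a} {d} eq = begin
      q ∙ d ∙ p              ≈⟨ ∙-congʳ (∙-congˡ eq) ⟨
      q ∙ (p ∙ a ∙ q) ∙ p    ≈⟨ ∙-congʳ (∙-congˡ (assoc p a q)) ⟩
      q ∙ (p ∙ (a ∙ q)) ∙ p  ≈⟨ ∙-congʳ (assoc q p (a ∙ q)) ⟨
      q ∙ p ∙ (a ∙ q) ∙ p    ≈⟨ ∙-congʳ (trans (∙-congʳ q∙p≈ε) (identityˡ _)) ⟩
      a ∙ q ∙ p              ≈⟨ assoc a q p ⟩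
      a ∙ (q ∙ p)            ≈⟨ trans (∙-congˡ q∙p≈ε) (identityʳ a) ⟩
      a                      ∎

-- Real matrices and the generalized inverse

module Matrices {c ℓ₁ ℓ₂} (ℝ : RealField c ℓ₁ ℓ₂) where

  commutativeRing : CommutativeRing c ℓ₁
  commutativeRing = record { isCommutativeRing = RealField.isCommutativeRing ℝ }

  open CommutativeRing commutativeRing public hiding (zero)
  open OverReals ℝ
  open Algebra.Properties.Semiring.Sum semiring public
    using (sum; sum-cong-≋; sum-replicate-zero; ∑-comm; ∑-distrib-+; *-distribˡ-sum; *-distribʳ-sum)
  open Relation.Binary.Reasoning.Setoid setoid

  sum-≈0 : ∀ {n} (f : Fin n → Carrier) → (∀ i → f i ≈ 0#) → sum f ≈ 0#
  sum-≈0 {n} f f≈0 = trans (sum-cong-≋ f≈0) (sum-replicate-zero n)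

  sum-single-≈ : ∀ {n} (f : Fin n → Carrier) i → (∀ j → j ≢ i → f j ≈ 0#) → sum f ≈ f i
  sum-single-≈ f zero    f≈0 =
    trans (+-congˡ (sum-≈0 (f ∘ suc) (λ j → f≈0 (suc j) λ ()))) (+-identityʳ _)
  sum-single-≈ f (suc i) f≈0 = trans (+-cong (f≈0 zero λ ())
    (sum-single-≈ (f ∘ suc) i (λ j j≢i → f≈0 (suc j) (j≢i ∘ Fin.suc-injective)))) (+-identityˡ _)

  diag-≡ : ∀ {n} (d : Fin n → Carrier) i → diag d i i ≈ d i
  diag-≡ d i with i Fin.≟ i
  ... | yes _  = refl
  ... | no i≢i = contradiction ≡.refl i≢i

  diag-≢ : ∀ {n} (d : Fin n → Carrier) {i j} → i ≢ j → diag d i j ≈ 0#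
  diag-≢ d {i} {j} i≢j with i Fin.≟ j
  ... | yes i≡j = contradiction i≡j i≢j
  ... | no _    = refl

  diag-⊗ : ∀ {n} (d : Fin n → Carrier) (X : Matrix n) i j → (diag d ⊗ X) i j ≈ d i * X i j
  diag-⊗ d X i j = trans
    (sum-single-≈ (λ l → diag d i l * X l j) i
      (λ l l≢i → trans (*-congʳ (diag-≢ d (l≢i ∘ ≡.sym))) (zeroˡ _)))
    (*-congʳ (diag-≡ d i))

  ⊗-diag : ∀ {n} (X : Matrix n) (d : Fin n → Carrier) i j → (X ⊗ diag d) i j ≈ X i j * d j
  ⊗-diag X d i j = trans
    (sum-single-≈ (λ l → X i l * diag d l j) j
      (λ l l≢j → trans (*-congˡ (diag-≢ d l≢j)) (zeroʳ _)))
    (*-congˡ (diag-≡ d j))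

  diag-⊗-diag : ∀ {n} (d e : Fin n → Carrier) → diag d ⊗ diag e ≋ diag (λ i → d i * e i)
  diag-⊗-diag d e i j with i Fin.≟ j
  ... | yes ≡.refl = begin
    (diag d ⊗ diag e) i i       ≈⟨ diag-⊗ d (diag e) i i ⟩
    d i * diag e i i            ≈⟨ *-congˡ (diag-≡ e i) ⟩
    d i * e i                   ∎
  ... | no i≢j = begin
    (diag d ⊗ diag e) i j       ≈⟨ diag-⊗ d (diag e) i j ⟩
    d i * diag e i j            ≈⟨ *-congˡ (diag-≢ e i≢j) ⟩
    d i * 0#                    ≈⟨ zeroʳ (d i) ⟩
    0#                          ∎

  diag-cong : ∀ {n} {d e : Fin n → Carrier} → (∀ i → d i ≈ e i) → diag d ≋ diag e
  diag-cong d≈e i j with i Fin.≟ j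
  ... | yes _ = d≈e i
  ... | no _  = refl

  ⊗-cong : ∀ {n} {X X′ Y Y′ : Matrix n} → X ≋ X′ → Y ≋ Y′ → X ⊗ Y ≋ X′ ⊗ Y′
  ⊗-cong X≋X′ Y≋Y′ i j = sum-cong-≋ (λ l → *-cong (X≋X′ i l) (Y≋Y′ l j))

  ⊗-assoc : ∀ {n} (X Y Z : Matrix n) → X ⊗ Y ⊗ Z ≋ X ⊗ (Y ⊗ Z)
  ⊗-assoc X Y Z i j = begin
    sum (λ l → sum (λ k → X i k * Y k l) * Z l j)
      ≈⟨ sum-cong-≋ (λ l → *-distribʳ-sum (Z l j) (λ k → X i k * Y k l)) ⟩
    sum (λ l → sum (λ k → X i k * Y k l * Z l j))
      ≈⟨ ∑-comm (λ l k → X i k * Y k l * Z l j) ⟩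
    sum (λ k → sum (λ l → X i k * Y k l * Z l j))
      ≈⟨ sum-cong-≋ (λ k → sum-cong-≋ (λ l → *-assoc (X i k) (Y k l) (Z l j))) ⟩
    sum (λ k → sum (λ l → X i k * (Y k l * Z l j)))
      ≈⟨ sum-cong-≋ (λ k → *-distribˡ-sum (X i k) (λ l → Y k l * Z l j)) ⟨
    sum (λ k → X i k * sum (λ l → Y k l * Z l j)) ∎

  ⊗-ᵀ : ∀ {n} (X Y : Matrix n) → (X ⊗ Y) ᵀ ≋ Y ᵀ ⊗ X ᵀ
  ⊗-ᵀ X Y i j = sum-cong-≋ (λ l → *-comm (X j l) (Y l i))

  matrixMonoid : ℕ → Monoid c ℓ₁
  matrixMonoid n = record
    { Carrier  = Matrix n
    ; _≈_      = _≋_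
    ; _∙_      = _⊗_
    ; ε        = I
    ; isMonoid = record
      { isSemigroup = record
        { isMagma = record
          { isEquivalence = record
            { refl  = λ _ _ → refl
            ; sym   = λ X≋Y i j → sym (X≋Y i j)
            ; trans = λ X≋Y Y≋Z i j → trans (X≋Y i j) (Y≋Z i j)
            }
          ; ∙-cong = ⊗-cong
          }
        ; assoc = ⊗-assoc
        }
      ; identity = (λ X i j → trans (diag-⊗ _ X i j) (*-identityˡ _))
                 , (λ X i j → trans (⊗-diag X _ i j) (*-identityʳ _))
      }
    }

  module _ {n : ℕ} where
    private module Mat = Monoid (matrixMonoid n)
    open GroupInverse (matrixMonoid n)

    diag-groupInverse : (d e : Fin n → Carrier) → (∀ i → d i * e i * d i ≈ d i) →
                        (∀ i → e i * d i * e i ≈ e i) → IsGroupInverse (diag d) (diag e)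
    diag-groupInverse d e ded ede = record
      { a∙x∙a = triple d e ded
      ; x∙a∙x = triple e d ede
      ; comm  = Mat.trans (diag-⊗-diag d e)
          (Mat.trans (diag-cong (λ i → *-comm (d i) (e i))) (Mat.sym (diag-⊗-diag e d)))
      }
      where
      triple : ∀ d e → (∀ i → d i * e i * d i ≈ d i) → diag d ⊗ diag e ⊗ diag d ≋ diag d
      triple d e ded = Mat.trans (⊗-cong (diag-⊗-diag d e) Mat.refl)
        (Mat.trans (diag-⊗-diag (λ i → d i * e i) d) (diag-cong ded))

    -- On the padding the product of d and e is 0 and not 1, so only the weaker law d e d = d holds
    -- at every index.
    pad-regular : ∀ {k} (d e : Fin k → Carrier) → (∀ i → e i * d i ≈ 1#) →
                  ∀ (i : Fin n) → pad d i * pad e i * pad d i ≈ pad d i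
    pad-regular {k} d e ed≈1 i with toℕ i ℕ.<? k
    ... | yes i<k = trans (*-assoc _ _ _) (trans (*-congˡ (ed≈1 _)) (*-identityʳ _))
    ... | no _    = zeroʳ _

    A*-groupInverse : ∀ {A : Matrix n} (δ : Diagonalisation A) →
                      IsGroupInverse A (Diagonalisation.A* δ)
    A*-groupInverse {A} δ = respˡ (unconjugate (proj₁ orthogonal) (proj₂ orthogonal) diagonalises)
      (conjugate (proj₁ orthogonal) (proj₂ orthogonal)
        (diag-groupInverse (pad eigenvalue) (pad eigenvalue⁻¹)
          (pad-regular eigenvalue eigenvalue⁻¹ ⁻¹-inverse)
          (pad-regular eigenvalue⁻¹ eigenvalue (λ i → trans (*-comm _ _) (⁻¹-inverse i)))))
      where
      open Diagonalisation δ
      eigenvalue⁻¹ : Fin k → Carrier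
      eigenvalue⁻¹ i = inv (eigenvalue i) (nonzero i)
      ⁻¹-inverse : ∀ i → eigenvalue⁻¹ i * eigenvalue i ≈ 1#
      ⁻¹-inverse i = inv-inverse (eigenvalue i) (nonzero i)

    -- As I and Z are symmetric, so is A B, and symmetric matrices with a symmetric product commute.
    -- Multiplying A B + Z = I by A and using A Z = 0 gives A A B = A, hence A B A = A. Finally B A
    -- B = A B A Y = A Y = B.
    symmetric-groupInverse : ∀ {A B Y Z : Matrix n} → A ᵀ ≋ A → B ᵀ ≋ B → Z ᵀ ≋ Z →
      (∀ i j → (A ⊗ B) i j + Z i j ≈ I i j) → (∀ i j → (A ⊗ Z) i j ≈ 0#) → B ≋ A ⊗ Y →
      IsGroupInverse A B
    symmetric-groupInverse {A} {B} {Y} {Z} Aᵀ Bᵀ Zᵀ AB+Z≋I AZ≋0 B≋AY = record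
      { a∙x∙a = ABA≋A
      ; x∙a∙x = Mat.trans (⊗-cong (Mat.sym AB≋BA) B≋AY) (Mat.trans (Mat.sym (⊗-assoc (A ⊗ B) A Y))
                  (Mat.trans (⊗-cong ABA≋A Mat.refl) (Mat.sym B≋AY)))
      ; comm  = AB≋BA
      }
      where
      open import Algebra.Properties.Group +-group using (∙-cancelʳ)
      AB-sym : (A ⊗ B) ᵀ ≋ A ⊗ B
      AB-sym i j = ∙-cancelʳ (Z i j) _ _ (begin
        (A ⊗ B) j i + Z i j  ≈⟨ +-congˡ (Zᵀ i j) ⟨
        (A ⊗ B) j i + Z j i  ≈⟨ AB+Z≋I j i ⟩
        I j i                ≈⟨ diag-sym _ i j ⟩
        I i j                ≈⟨ AB+Z≋I i j ⟨
        (A ⊗ B) i j + Z i j  ∎)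
      AB≋BA : A ⊗ B ≋ B ⊗ A
      AB≋BA = Mat.trans (Mat.sym AB-sym) (Mat.trans (⊗-ᵀ A B) (⊗-cong Bᵀ Aᵀ))
      A[AB]≋A : A ⊗ (A ⊗ B) ≋ A
      A[AB]≋A i j = begin
        (A ⊗ (A ⊗ B)) i j                                 ≈⟨ +-identityʳ _ ⟨
        (A ⊗ (A ⊗ B)) i j + 0#                            ≈⟨ +-congˡ (AZ≋0 i j) ⟨
        (A ⊗ (A ⊗ B)) i j + (A ⊗ Z) i j                   ≈⟨ ∑-distrib-+ (λ l → A i l * (A ⊗ B) l j) (λ l → A i l * Z l j) ⟨
        sum (λ l → A i l * (A ⊗ B) l j + A i l * Z l j)   ≈⟨ sum-cong-≋ (λ l → distribˡ (A i l) _ _) ⟨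
        sum (λ l → A i l * ((A ⊗ B) l j + Z l j))         ≈⟨ sum-cong-≋ (λ l → *-congˡ (AB+Z≋I l j)) ⟩
        (A ⊗ I) i j                                       ≈⟨ Mat.identityʳ A i j ⟩
        A i j                                             ∎
      ABA≋A : A ⊗ B ⊗ A ≋ A
      ABA≋A = Mat.trans (⊗-assoc A B A) (Mat.trans (⊗-cong Mat.refl (Mat.sym AB≋BA)) A[AB]≋A)

open Matchings

-- The recurrence between layers of path-avoiding matchings

module PathMatrices {c ℓ₁ ℓ₂} (ℝ : RealField c ℓ₁ ℓ₂)
                    {n} (G : Graph n) (tree : Graph.IsTree G) where
  open RealField ℝ using (_#_; #-irrefl; invertible⇒#; _·_)
  open OverReals ℝ
  open Matrices ℝ
  open Graph G
  open TreePaths G tree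
  open MaximumMatchings G
  open Algebra.Properties.Semiring.Mult semiring using (×-homo-+; ×-homo-1)
  open Algebra.Properties.Ring ring using (-0#≈0#; -‿involutive; -‿distribˡ-*)
  open Algebra.Properties.CommutativeSemigroup *-commutativeSemigroup
    using () renaming (interchange to *-interchange)
  open Relation.Binary.Reasoning.Setoid setoid

  ⟦_⟧ : ℕ → Carrier
  ⟦ k ⟧ = k · 1#

  ⟦⟧-sum : ∀ {k} (f : Fin k → ℕ) → ⟦ ℕΣ.sum f ⟧ ≈ sum (λ i → ⟦ f i ⟧)
  ⟦⟧-sum {zero}  f = refl
  ⟦⟧-sum {suc k} f = trans (×-homo-+ 1# (f zero) _) (+-congˡ (⟦⟧-sum (f ∘ suc)))

  sign : ℕ → Carrier
  sign k = fromℤ (σ k)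

  fromℤ-neg : ∀ z → fromℤ (ℤ.- z) ≈ - fromℤ z
  fromℤ-neg (+ zero)  = sym -0#≈0#
  fromℤ-neg (+ suc k) = refl
  fromℤ-neg -[1+ k ]  = sym (-‿involutive _)

  sign-+2 : ∀ k → sign (2 ℕ.+ k) ≈ - sign k
  sign-+2 k = trans (reflexive (≡.cong fromℤ (σ-+2 k))) (fromℤ-neg (σ k))

  A : Matrix n
  A = adjacencyMatrix G

  A-adjacent : ∀ {u v} → u ~ v → A u v ≈ 1#
  A-adjacent {u} {v} u~v with true ← adj u v = refl

  A-nonadjacent : ∀ {u v} → ¬ u ~ v → A u v ≈ 0#
  A-nonadjacent {u} {v} u≁v with adj u v
  ... | true  = contradiction tt u≁v
  ... | false = refl

  A-sym : A ᵀ ≋ A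
  A-sym u v = reflexive (≡.cong (λ b → if b then 1# else 0#) (adj-sym v u))

  -- Up to sign, W a ℓ u v is the coefficient of x ^ (n - ℓ) in the entry φ(T - P)
  -- of the adjugate of x I - A; a shifts σ to the parity of dist u v that matters.
  W : ℕ → ℕ → Matrix n
  W a ℓ u v = sign (a ℕ.+ dist u v) * ⟦ #config G ℓ (between u v) [] ⟧

  W-sym : ∀ a ℓ → W a ℓ ᵀ ≋ W a ℓ
  W-sym a ℓ u v = reflexive (≡.cong₂ (λ d N → sign (a ℕ.+ d) * ⟦ N ⟧)
    (dist-sym v u) (#config-↭ G ℓ [] (between-sym v u)))

  W-extend : ∀ a ℓ {u v w} → w ~ u → w ∉ between u v →
             W a ℓ w v ≈ sign (a ℕ.+ suc (dist u v)) * ⟦ #config G ℓ (w ∷ between u v) [] ⟧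
  W-extend a ℓ w~u w∉ = let eq , d = between-extend w~u w∉ in
    reflexive (≡.cong₂ (λ d S → sign (a ℕ.+ d) * ⟦ #config G ℓ S [] ⟧) d eq)

  deletion : ∀ s ℓ {u S} → u ∉ S →
    s * ⟦ #config G ℓ S [] ⟧ ≈
    s * ⟦ #config G (suc ℓ) (u ∷ S) [] ⟧ + sum (λ w → s * ⟦ extensions G ℓ S u w ⟧)
  deletion s ℓ {u} {S} u∉S = begin
    s * ⟦ #config G ℓ S [] ⟧
      ≈⟨ *-congˡ (reflexive (≡.cong ⟦_⟧ (#config-deletion G ℓ u∉S))) ⟩
    s * ⟦ #config G (suc ℓ) (u ∷ S) [] ℕ.+ ℕΣ.sum (extensions G ℓ S u) ⟧
      ≈⟨ *-congˡ (×-homo-+ 1# (#config G (suc ℓ) (u ∷ S) []) _) ⟩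
    s * (⟦ #config G (suc ℓ) (u ∷ S) [] ⟧ + ⟦ ℕΣ.sum (extensions G ℓ S u) ⟧)
      ≈⟨ distribˡ s _ _ ⟩
    s * ⟦ #config G (suc ℓ) (u ∷ S) [] ⟧ + s * ⟦ ℕΣ.sum (extensions G ℓ S u) ⟧
      ≈⟨ +-congˡ (*-congˡ (⟦⟧-sum (extensions G ℓ S u))) ⟩
    s * ⟦ #config G (suc ℓ) (u ∷ S) [] ⟧ + s * sum (λ w → ⟦ extensions G ℓ S u w ⟧)
      ≈⟨ +-congˡ (*-distribˡ-sum s (λ w → ⟦ extensions G ℓ S u w ⟧)) ⟩
    s * ⟦ #config G (suc ℓ) (u ∷ S) [] ⟧ + sum (λ w → s * ⟦ extensions G ℓ S u w ⟧) ∎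

  -- The matchings of the whole tree are sorted by what happens at v: matched to a neighbour w,
  -- counted by the path from w to v, or exposed, counted one layer up by the path of length 0.
  -- Raising the shift with the layer gives both kinds the same sign.
  A⊗W-diagonal : ∀ a ℓ v → (A ⊗ W a ℓ) v v + W (suc a) (suc ℓ) v v ≈
                            sign (suc a) * ⟦ #config G ℓ [] [] ⟧
  A⊗W-diagonal a ℓ v = begin
    (A ⊗ W a ℓ) v v + W (suc a) (suc ℓ) v v
      ≈⟨ +-cong (sum-cong-≋ neighbour) here-v ⟩
    sum (λ w → s * ⟦ extensions G ℓ [] v w ⟧) + s * ⟦ #config G (suc ℓ) (v ∷ []) [] ⟧
      ≈⟨ +-comm _ _ ⟩
    s * ⟦ #config G (suc ℓ) (v ∷ []) [] ⟧ + sum (λ w → s * ⟦ extensions G ℓ [] v w ⟧)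
      ≈⟨ deletion s ℓ (λ ()) ⟨
    s * ⟦ #config G ℓ [] [] ⟧ ∎
    where
    s : Carrier
    s = sign (suc a)
    here-v : W (suc a) (suc ℓ) v v ≈ s * ⟦ #config G (suc ℓ) (v ∷ []) [] ⟧
    here-v = reflexive (≡.cong₂ (λ d S → sign d * ⟦ #config G (suc ℓ) S [] ⟧)
      (≡.trans (≡.cong (suc a ℕ.+_) (dist-refl v)) (ℕ.+-identityʳ _)) (between-refl v))
    neighbour : ∀ w → A v w * W a ℓ w v ≈ s * ⟦ extensions G ℓ [] v w ⟧
    neighbour w with Bool.T? (adj v w)
    ... | no v≁w = begin
      A v w * W a ℓ w v               ≈⟨ *-congʳ (A-nonadjacent v≁w) ⟩
      0# * W a ℓ w v                  ≈⟨ zeroˡ _ ⟩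
      0#                              ≈⟨ zeroʳ s ⟨
      s * ⟦ 0 ⟧                       ≈⟨ reflexive (≡.cong (λ N → s * ⟦ N ⟧) (extensions-no G ℓ (v≁w ∘ proj₁))) ⟨
      s * ⟦ extensions G ℓ [] v w ⟧   ∎
    ... | yes v~w = begin
      A v w * W a ℓ w v
        ≈⟨ *-congʳ (A-adjacent v~w) ⟩
      1# * W a ℓ w v
        ≈⟨ *-identityˡ _ ⟩
      W a ℓ w v
        ≈⟨ W-extend a ℓ (~-sym G v~w) w∉ ⟩
      sign (a ℕ.+ suc (dist v v)) * ⟦ #config G ℓ (w ∷ between v v) [] ⟧
        ≈⟨ reflexive (≡.cong₂ (λ d S → sign d * ⟦ #config G ℓ (w ∷ S) [] ⟧) dist≡ (between-refl v)) ⟩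
      s * ⟦ #config G ℓ (w ∷ v ∷ []) [] ⟧
        ≈⟨ reflexive (≡.cong (λ N → s * ⟦ N ⟧) (extensions-yes G ℓ v~w (λ ()))) ⟨
      s * ⟦ extensions G ℓ [] v w ⟧ ∎
      where
      w∉ : w ∉ between v v
      w∉ w∈ with here ≡.refl ← ≡.subst (w ∈_) (between-refl v) w∈ = adj⇒≢ G v~w ≡.refl
      dist≡ : a ℕ.+ suc (dist v v) ≡ suc a
      dist≡ = ≡.trans (ℕ.+-suc a _) (≡.cong suc
        (≡.trans (≡.cong (a ℕ.+_) (dist-refl v)) (ℕ.+-identityʳ a)))

  -- The vertex u is deleted from the tree without the path from `next` to v. The neighbour `next`
  -- contributes all matchings there; any other neighbour w is two steps further from v, so the sign
  -- flips and the matchings containing uw are subtracted. Those exposing u remain, and the term of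
  -- the next layer cancels them.
  A⊗W-offDiagonal : ∀ a ℓ {u v} → u ≢ v → (A ⊗ W a ℓ) u v + W (suc a) (suc ℓ) u v ≈ 0#
  A⊗W-offDiagonal a ℓ {u} {v} u≢v = begin
    (A ⊗ W a ℓ) u v + W (suc a) (suc ℓ) u v    ≈⟨ +-cong AW here-u ⟩
    s * ⟦ N′ ⟧ + (- s) * ⟦ N′ ⟧                ≈⟨ distribʳ _ s (- s) ⟨
    (s + - s) * ⟦ N′ ⟧                         ≈⟨ *-congʳ (-‿inverseʳ s) ⟩
    0# * ⟦ N′ ⟧                                ≈⟨ zeroˡ _ ⟩
    0#                                         ∎
    where
    open FirstStep (firstStep u≢v)
    open import Algebra.Properties.Group +-group using (∙-cancelʳ)
    S : List (Fin n)
    S = between next v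
    N N′ : ℕ
    N  = #config G ℓ S []
    N′ = #config G (suc ℓ) (u ∷ S) []
    s : Carrier
    s = sign (a ℕ.+ dist next v)
    sign+2 : ∀ {d} → d ≡ suc (suc (a ℕ.+ dist next v)) → sign d ≈ - s
    sign+2 d≡ = trans (reflexive (≡.cong sign d≡)) (sign-+2 (a ℕ.+ dist next v))
    here-u : W (suc a) (suc ℓ) u v ≈ (- s) * ⟦ N′ ⟧
    here-u = *-cong (sign+2 (≡.trans (≡.cong (suc a ℕ.+_) dist-next) (ℕ.+-suc (suc a) _)))
      (reflexive (≡.cong (λ S → ⟦ #config G (suc ℓ) S [] ⟧) between-next))
    -- Adding the matchings that contain uw to each product cancels every index but `next`, so the
    -- sum over neighbours collapses to one term.
    term : Fin n → Carrier
    term w = A u w * W a ℓ w v + s * ⟦ extensions G ℓ S u w ⟧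
    no-extension : ∀ {w} → ¬ (u ~ w × w ∉ S) → s * ⟦ extensions G ℓ S u w ⟧ ≈ 0#
    no-extension ¬ext = trans (reflexive (≡.cong (λ N → s * ⟦ N ⟧) (extensions-no G ℓ ¬ext))) (zeroʳ s)
    term-next : term next ≈ s * ⟦ N ⟧
    term-next = begin
      A u next * W a ℓ next v + s * ⟦ extensions G ℓ S u next ⟧
        ≈⟨ +-cong (*-congʳ (A-adjacent adjacent)) (no-extension (λ (_ , ∉S) → ∉S (source-∈ G (path next v)))) ⟩
      1# * W a ℓ next v + 0#
        ≈⟨ trans (+-identityʳ _) (*-identityˡ _) ⟩
      s * ⟦ N ⟧ ∎
    term-other : ∀ w → w ≢ next → term w ≈ 0#
    term-other w w≢next with Bool.T? (adj u w)
    ... | no u≁w = begin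
      term w                ≈⟨ +-cong (*-congʳ (A-nonadjacent u≁w)) (no-extension (u≁w ∘ proj₁)) ⟩
      0# * W a ℓ w v + 0#   ≈⟨ trans (+-identityʳ _) (zeroˡ _) ⟩
      0#                    ∎
    ... | yes u~w = begin
      A u w * W a ℓ w v + s * ⟦ extensions G ℓ S u w ⟧
        ≈⟨ +-cong (trans (*-congʳ (A-adjacent u~w)) (*-identityˡ _))
                  (reflexive (≡.cong (λ N → s * ⟦ N ⟧) (extensions-yes G ℓ u~w w∉S))) ⟩
      W a ℓ w v + s * ⟦ #config G ℓ (w ∷ u ∷ S) [] ⟧
        ≈⟨ +-congʳ (W-extend a ℓ (~-sym G u~w) w∉) ⟩
      sign (a ℕ.+ suc (dist u v)) * ⟦ #config G ℓ (w ∷ between u v) [] ⟧ +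
      s * ⟦ #config G ℓ (w ∷ u ∷ S) [] ⟧
        ≈⟨ +-congʳ (*-cong (sign+2 dist≡) (reflexive (≡.cong (λ S → ⟦ #config G ℓ (w ∷ S) [] ⟧) between-next))) ⟩
      (- s) * ⟦ #config G ℓ (w ∷ u ∷ S) [] ⟧ + s * ⟦ #config G ℓ (w ∷ u ∷ S) [] ⟧
        ≈⟨ distribʳ _ (- s) s ⟨
      (- s + s) * ⟦ #config G ℓ (w ∷ u ∷ S) [] ⟧
        ≈⟨ trans (*-congʳ (-‿inverseˡ s)) (zeroˡ _) ⟩
      0# ∎
      where
      w∉S : w ∉ S
      w∉S w∈S = w≢next (next-unique u~w w∈S)
      w∉ : w ∉ between u v
      w∉ w∈ with ≡.subst (w ∈_) between-next w∈
      ... | here w≡u  = adj⇒≢ G u~w (≡.sym w≡u)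
      ... | there w∈S = w∉S w∈S
      dist≡ : a ℕ.+ suc (dist u v) ≡ suc (suc (a ℕ.+ dist next v))
      dist≡ = ≡.trans (ℕ.+-suc a _) (≡.cong suc
        (≡.trans (≡.cong (a ℕ.+_) dist-next) (ℕ.+-suc a _)))
    AW : (A ⊗ W a ℓ) u v ≈ s * ⟦ N′ ⟧
    AW = ∙-cancelʳ (sum (λ w → s * ⟦ extensions G ℓ S u w ⟧)) _ _ (begin
      (A ⊗ W a ℓ) u v + sum (λ w → s * ⟦ extensions G ℓ S u w ⟧)
        ≈⟨ ∑-distrib-+ (λ w → A u w * W a ℓ w v) (λ w → s * ⟦ extensions G ℓ S u w ⟧) ⟨
      sum term
        ≈⟨ trans (sum-single-≈ term next term-other) term-next ⟩
      s * ⟦ N ⟧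
        ≈⟨ deletion s ℓ source-∉ ⟩
      s * ⟦ N′ ⟧ + sum (λ w → s * ⟦ extensions G ℓ S u w ⟧) ∎)

  A⊗W : ∀ a ℓ i j → (A ⊗ W a ℓ) i j + W (suc a) (suc ℓ) i j ≈
                    diag (λ _ → sign (suc a) * ⟦ #config G ℓ [] [] ⟧) i j
  A⊗W a ℓ i j with i Fin.≟ j
  ... | yes ≡.refl = A⊗W-diagonal a ℓ i
  ... | no i≢j     = A⊗W-offDiagonal a ℓ i≢j

  -- Normalisation by m(T), and the three layers around 2ν

  abstract
    m⁻¹ : Carrier
    m⁻¹ = inv ⟦ m G ⟧ (·1#0 (m G) {{m-nonZero G}})

    m⁻¹-inverse : m⁻¹ * ⟦ m G ⟧ ≈ 1#
    m⁻¹-inverse = inv-inverse ⟦ m G ⟧ (·1#0 (m G) {{m-nonZero G}})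

    /-m : ∀ z → (z / m G) {{m-nonZero G}} ≈ fromℤ z * m⁻¹
    /-m z = refl

  V : ℕ → ℕ → Matrix n
  V a ℓ u v = W a ℓ u v * m⁻¹

  V-sym : ∀ a ℓ → V a ℓ ᵀ ≋ V a ℓ
  V-sym a ℓ u v = *-congʳ (W-sym a ℓ u v)

  V-+2 : ∀ a ℓ i j → V (2 ℕ.+ a) ℓ i j ≈ - V a ℓ i j
  V-+2 a ℓ i j = begin
    sign (2 ℕ.+ (a ℕ.+ dist i j)) * N * m⁻¹   ≈⟨ *-congʳ (*-congʳ (sign-+2 (a ℕ.+ dist i j))) ⟩
    (- sign (a ℕ.+ dist i j)) * N * m⁻¹       ≈⟨ *-congʳ (-‿distribˡ-* _ N) ⟨
    (- W a ℓ i j) * m⁻¹                       ≈⟨ -‿distribˡ-* _ m⁻¹ ⟨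
    - V a ℓ i j                               ∎
    where
    N : Carrier
    N = ⟦ #config G ℓ (between i j) [] ⟧

  A⊗V : ∀ a ℓ i j → (A ⊗ V a ℓ) i j + V (suc a) (suc ℓ) i j ≈
                    diag (λ _ → sign (suc a) * ⟦ #config G ℓ [] [] ⟧ * m⁻¹) i j
  A⊗V a ℓ i j = begin
    sum (λ l → A i l * (W a ℓ l j * m⁻¹)) + W (suc a) (suc ℓ) i j * m⁻¹
      ≈⟨ +-congʳ (sum-cong-≋ (λ l → *-assoc (A i l) _ _)) ⟨
    sum (λ l → A i l * W a ℓ l j * m⁻¹) + W (suc a) (suc ℓ) i j * m⁻¹
      ≈⟨ +-congʳ (*-distribʳ-sum m⁻¹ (λ l → A i l * W a ℓ l j)) ⟨
    (A ⊗ W a ℓ) i j * m⁻¹ + W (suc a) (suc ℓ) i j * m⁻¹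
      ≈⟨ distribʳ m⁻¹ _ _ ⟨
    ((A ⊗ W a ℓ) i j + W (suc a) (suc ℓ) i j) * m⁻¹
      ≈⟨ *-congʳ (A⊗W a ℓ i j) ⟩
    diag (λ _ → sign (suc a) * ⟦ #config G ℓ [] [] ⟧) i j * m⁻¹
      ≈⟨ diag-* i j ⟩
    diag (λ _ → sign (suc a) * ⟦ #config G ℓ [] [] ⟧ * m⁻¹) i j ∎
    where
    diag-* : ∀ {x} (i j : Fin n) → diag (λ _ → x) i j * m⁻¹ ≈ diag (λ _ → x * m⁻¹) i j
    diag-* i j with i Fin.≟ j
    ... | yes _ = refl
    ... | no _  = zeroˡ _

  -- These are the powers of x missing from φ(T). The vanishing is supplied by σ, which is 0 at even
  -- arguments, whatever the count.
  A⊗V-even : ∀ a ℓ → sign (suc a) ≈ 0# → ∀ i j → (A ⊗ V a ℓ) i j + V (suc a) (suc ℓ) i j ≈ 0#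
  A⊗V-even a ℓ sign≈0 i j = trans (A⊗V a ℓ i j) (diag-0 i j)
    where
    diag-0 : ∀ i j → diag (λ _ → sign (suc a) * ⟦ #config G ℓ [] [] ⟧ * m⁻¹) i j ≈ 0#
    diag-0 i j with i Fin.≟ j
    ... | yes _ = trans (*-congʳ (trans (*-congʳ sign≈0) (zeroˡ _))) (zeroˡ _)
    ... | no _  = refl

  -- The lowest power of x in φ(T) is x ^ (n - K), and its coefficient is m(T) up to sign.
  K : ℕ
  K = 2 ℕ.* ν

  -- `Z` turns out to be the orthogonal projection onto the kernel of A. Its shift 1 selects the
  -- even distances, as that of `B` selects the odd ones.
  B Z : Matrix n
  B = V 0 K
  Z = V 1 (1 ℕ.+ K)

  A⊗B+Z≋I : ∀ i j → (A ⊗ B) i j + Z i j ≈ I i j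
  A⊗B+Z≋I i j = trans (A⊗V 0 K i j) (diag-cong {d = λ _ → sign 1 * ⟦ #config G K [] [] ⟧ * m⁻¹}
    (λ _ → unit) i j)
    where
    unit : sign 1 * ⟦ #config G K [] [] ⟧ * m⁻¹ ≈ 1#
    unit = begin
      sign 1 * ⟦ #config G K [] [] ⟧ * m⁻¹
        ≈⟨ *-congʳ (trans (*-congʳ (×-homo-1 1#)) (*-identityˡ _)) ⟩
      ⟦ #config G K [] [] ⟧ * m⁻¹
        ≈⟨ *-congʳ (reflexive (≡.cong ⟦_⟧ m≡#config)) ⟨
      ⟦ m G ⟧ * m⁻¹
        ≈⟨ *-comm _ _ ⟩
      m⁻¹ * ⟦ m G ⟧
        ≈⟨ m⁻¹-inverse ⟩
      1# ∎

  A⊗Z≋0 : ∀ i j → (A ⊗ Z) i j ≈ 0#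
  A⊗Z≋0 i j = begin
    (A ⊗ Z) i j                           ≈⟨ +-identityʳ _ ⟨
    (A ⊗ Z) i j + 0#                      ≈⟨ +-congˡ V≈0 ⟨
    (A ⊗ Z) i j + V 2 (2 ℕ.+ K) i j       ≈⟨ A⊗V-even 1 (1 ℕ.+ K) refl i j ⟩
    0#                                    ∎
    where
    -- At odd distance, a counted matching together with every other edge of the path would have ν +
    -- 1 edges; at even distance the sign is 0.
    W≈0 : W 2 (2 ℕ.+ K) i j ≈ 0#
    W≈0 with paired-or-even G (path i j)
    ... | inj₁ pair = trans (*-congˡ (reflexive (≡.cong ⟦_⟧
      (#config-beyond (ℕ.m≤n+m (suc K) 1) pair (path! i j))))) (zeroʳ _)
    ... | inj₂ even = trans (*-congʳ (trans (sign-+2 (dist i j))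
      (trans (-‿cong (reflexive (≡.cong fromℤ even))) -0#≈0#))) (zeroˡ _)
    V≈0 : V 2 (2 ℕ.+ K) i j ≈ 0#
    V≈0 = trans (*-congʳ W≈0) (zeroˡ _)

  -- Shifts 0 and 2 differ by a factor -1, so the recurrence at shift 1, whose right-hand side is 0,
  -- reads `V 0 (suc ℓ)` = A `V 1 ℓ`. K is generalised to ℓ only for a case split: ℓ = 0 has no
  -- earlier layer, but there no path fits and the matrix is 0.
  B-factors : ∃[ Y ] B ≋ A ⊗ Y
  B-factors = factor K
    where
    factor : ∀ ℓ → ∃[ Y ] V 0 ℓ ≋ A ⊗ Y
    factor zero    = (λ _ _ → 0#) , λ i j → begin
      W 0 0 i j * m⁻¹           ≈⟨ *-congʳ (W≈0 i j) ⟩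
      0# * m⁻¹                  ≈⟨ zeroˡ _ ⟩
      0#                        ≈⟨ sum-≈0 (λ l → A i l * 0#) (λ l → zeroʳ _) ⟨
      sum (λ l → A i l * 0#)    ∎
      where
      W≈0 : ∀ i j → W 0 0 i j ≈ 0#
      W≈0 i j = trans (*-congˡ (reflexive (≡.cong ⟦_⟧ (none (path i j))))) (zeroʳ _)
        where
        none : ∀ {u v k} (p : Walk u v k) → #config G 0 (vertices p) [] ≡ 0
        none []      = #config-0-∷ _ _
        none (_ ∷ _) = #config-0-∷ _ _
    factor (suc ℓ) = V 1 ℓ , λ i j → ∙-cancelʳ (V 2 (suc ℓ) i j) _ _ (begin
      V 0 (suc ℓ) i j + V 2 (suc ℓ) i j     ≈⟨ +-congˡ (V-+2 0 (suc ℓ) i j) ⟩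
      V 0 (suc ℓ) i j + - V 0 (suc ℓ) i j   ≈⟨ -‿inverseʳ _ ⟩
      0#                                    ≈⟨ A⊗V-even 1 ℓ refl i j ⟨
      (A ⊗ V 1 ℓ) i j + V 2 (suc ℓ) i j     ∎)
      where open import Algebra.Properties.Group +-group using (∙-cancelʳ)

  B-groupInverse : GroupInverse.IsGroupInverse (matrixMonoid n) A B
  B-groupInverse = symmetric-groupInverse A-sym (V-sym 0 K) (V-sym 1 (1 ℕ.+ K))
    A⊗B+Z≋I A⊗Z≋0 (proj₂ B-factors)

  A*≋B : (δ : Diagonalisation A) → Diagonalisation.A* δ ≋ B
  A*≋B δ = GroupInverse.unique (matrixMonoid n) (A*-groupInverse δ) B-groupInverse

  -- Entries of B: labels and edges

  fromℤ-σ* : ∀ k N → fromℤ (σ k ℤ.* + N) ≈ sign k * ⟦ N ⟧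
  fromℤ-σ* 0 N = sym (zeroˡ _)
  fromℤ-σ* 1 N = trans (reflexive (≡.cong fromℤ (ℤ.*-identityˡ (+ N))))
    (sym (trans (*-congʳ (×-homo-1 1#)) (*-identityˡ _)))
  fromℤ-σ* 2 N = sym (zeroˡ _)
  fromℤ-σ* 3 N = begin
    fromℤ (-[1+ 0 ] ℤ.* + N)  ≈⟨ reflexive (≡.cong fromℤ (ℤ.-1*i≡-i (+ N))) ⟩
    fromℤ (ℤ.- (+ N))         ≈⟨ fromℤ-neg (+ N) ⟩
    - ⟦ N ⟧                   ≈⟨ -‿cong (*-identityˡ _) ⟨
    - (1# * ⟦ N ⟧)            ≈⟨ -‿distribˡ-* 1# ⟦ N ⟧ ⟩
    (- 1#) * ⟦ N ⟧            ≈⟨ *-congʳ (-‿cong (×-homo-1 1#)) ⟨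
    (- ⟦ 1 ⟧) * ⟦ N ⟧         ∎
  fromℤ-σ* (suc (suc (suc (suc k)))) N = fromℤ-σ* k N

  -- At even distance the sign annihilates both sides, so the counts are compared only where the
  -- path has its pairs of vertices to trade.
  B≈numAlternating : ∀ u v → B u v ≈ sign (dist u v) * ⟦ numAlternating G u v ⟧ * m⁻¹
  B≈numAlternating u v = *-congʳ (numerator (paired-or-even G (path u v)))
    where
    numerator : Paired _~_ (between u v) ⊎ σ (dist u v) ≡ + 0 →
                W 0 K u v ≈ sign (dist u v) * ⟦ numAlternating G u v ⟧
    numerator (inj₁ pair) =
      *-congˡ (reflexive (≡.cong ⟦_⟧ (≡.sym (numAlternating≡#config tree pair))))
    numerator (inj₂ even) = trans (vanish _) (sym (vanish _))
      where
      vanish : ∀ x → sign (dist u v) * x ≈ 0#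
      vanish x = trans (*-congʳ (reflexive (≡.cong fromℤ even))) (zeroˡ x)

  B≈μ/m : ∀ u v → B u v ≈ (μ G tree u v / m G) {{m-nonZero G}}
  B≈μ/m u v = begin
    B u v
      ≈⟨ B≈numAlternating u v ⟩
    sign (dist u v) * ⟦ numAlternating G u v ⟧ * m⁻¹
      ≈⟨ *-congʳ (fromℤ-σ* (dist u v) (numAlternating G u v)) ⟨
    fromℤ (σ (dist u v) ℤ.* + numAlternating G u v) * m⁻¹
      ≈⟨ *-congʳ (reflexive (≡.cong (λ d → fromℤ (σ d ℤ.* + numAlternating G u v)) (dist≡distance u v))) ⟩
    fromℤ (μ G tree u v) * m⁻¹
      ≈⟨ /-m (μ G tree u v) ⟨
    (μ G tree u v / m G) {{m-nonZero G}} ∎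

  sign²≈1 : ∀ k → Odd k → sign k * sign k ≈ 1#
  sign²≈1 k (inj₁ eq) = trans (*-cong sign≈1 sign≈1) (*-identityˡ 1#)
    where sign≈1 = trans (reflexive (≡.cong fromℤ eq)) (×-homo-1 1#)
  sign²≈1 k (inj₂ eq) = begin
    _                ≈⟨ *-cong sign≈-1 sign≈-1 ⟩
    - 1# * - 1#      ≈⟨ -‿distribˡ-* 1# (- 1#) ⟨
    - (1# * - 1#)    ≈⟨ -‿cong (*-identityˡ _) ⟩
    - - 1#           ≈⟨ -‿involutive 1# ⟩
    1#               ∎
    where sign≈-1 = trans (reflexive (≡.cong fromℤ eq)) (-‿cong (×-homo-1 1#))

  unit⇒# : ∀ {x y} → x * y ≈ 1# → x # 0#
  unit⇒# {x} {y} xy≈1 = invertible⇒# (y , trans (*-comm _ _) x-0*y , x-0*y)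
    where
    x-0*y : (x + - 0#) * y ≈ 1#
    x-0*y = trans (*-congʳ (trans (+-congˡ -0#≈0#) (+-identityʳ x))) xy≈1

  -- Apartness from 0 has to come from an explicit inverse. At odd distance the sign is its own
  -- inverse, and the number of matchings is positive because M itself is counted.
  B-invertible : ∀ {u v M} → IsMaximumMatching G M → AlternatingPath G M u v →
        ∃[ y ] B u v * y ≈ 1#
  B-invertible {u} {v} {M} max alt@(k , p , p! , p-alt) = s * (N⁻¹ * ⟦ m G ⟧) , (begin
    B u v * (s * (N⁻¹ * ⟦ m G ⟧))
      ≈⟨ *-congʳ (B≈numAlternating u v) ⟩
    s * ⟦ N ⟧ * m⁻¹ * (s * (N⁻¹ * ⟦ m G ⟧))
      ≈⟨ *-congʳ (*-assoc s ⟦ N ⟧ m⁻¹) ⟩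
    s * (⟦ N ⟧ * m⁻¹) * (s * (N⁻¹ * ⟦ m G ⟧))
      ≈⟨ *-interchange s (⟦ N ⟧ * m⁻¹) s (N⁻¹ * ⟦ m G ⟧) ⟩
    s * s * (⟦ N ⟧ * m⁻¹ * (N⁻¹ * ⟦ m G ⟧))
      ≈⟨ *-cong (sign²≈1 (dist u v) odd) (*-interchange ⟦ N ⟧ m⁻¹ N⁻¹ ⟦ m G ⟧) ⟩
    1# * (⟦ N ⟧ * N⁻¹ * (m⁻¹ * ⟦ m G ⟧))
      ≈⟨ *-identityˡ _ ⟩
    ⟦ N ⟧ * N⁻¹ * (m⁻¹ * ⟦ m G ⟧)
      ≈⟨ *-cong (trans (*-comm _ _) (inv-inverse ⟦ N ⟧ (·1#0 N {{N≢0}}))) m⁻¹-inverse ⟩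
    1# * 1#
      ≈⟨ *-identityˡ 1# ⟩
    1# ∎)
    where
    N : ℕ
    N = numAlternating G u v
    N≢0 : NonZero N
    N≢0 = count-nonZero (λ M → isMaximumMatching? G M ×-dec alternatingPath? G M u v) (M , max , alt)
    s N⁻¹ : Carrier
    s = sign (dist u v)
    N⁻¹ = inv ⟦ N ⟧ (·1#0 N {{N≢0}})
    odd : Odd (dist u v)
    odd = ≡.subst Odd (≡.sym (dist-unique p p!)) (alternating⇒odd G p-alt)

  -- A count of 0 would make the entry equal to 0, against apartness. A nonzero count yields an
  -- actual matching by search through the finite list of edge sets, so no classical principle is
  -- involved.
  B-edge : ∀ {u v} → B u v # 0# → ∃[ M ] IsMaximumMatching G M × AlternatingPath G M u v
  B-edge {u} {v} B#0 = count-witness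
    (λ M → isMaximumMatching? G M ×-dec alternatingPath? G M u v)
    (λ none → #-irrefl (begin
      B u v
        ≈⟨ B≈numAlternating u v ⟩
      sign (dist u v) * ⟦ numAlternating G u v ⟧ * m⁻¹
        ≈⟨ *-congʳ (*-congˡ (reflexive (≡.cong ⟦_⟧ none))) ⟩
      sign (dist u v) * 0# * m⁻¹
        ≈⟨ trans (*-congʳ (zeroʳ _)) (zeroˡ _) ⟩
      0# ∎) B#0)

  #-resp-≈ : ∀ {x y} → x ≈ y → x # 0# → y # 0#
  #-resp-≈ x≈y x#0 =
    unit⇒# (trans (*-congʳ (sym x≈y)) (trans (*-comm _ _) (inv-inverse _ x#0)))

theorem1 : ∀ {c ℓ₁ ℓ₂} (ℝ : RealField c ℓ₁ ℓ₂) →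
    let open RealField ℝ using (_≈_)
        open OverReals ℝ
        open LabelledGraph
    in
    ∀ {n : ℕ} (T : Graph n) (tree : Graph.IsTree T) → 2 ≤ n →
    (δ : Diagonalisation (adjacencyMatrix T)) →
    let T* = generalizedInverse T δ in
    ∀ (u v : Fin n) → u ≢ v →
    (Edge T* u v ⇔ (∃[ M ] IsMaximumMatching T M × AlternatingPath T M u v))
    × (∀ (e : Edge T* u v) → label T* e ≈ (μ T tree u v / m T) {{m-nonZero T}})
theorem1 ℝ T tree _ δ u v _ =
  mk⇔ (λ e → B-edge (#-resp-≈ (A*≋B δ u v) e))
      (λ (M , max , alt) →
         unit⇒# (trans (*-congʳ (A*≋B δ u v)) (proj₂ (B-invertible max alt)))) ,
  (λ _ → trans (A*≋B δ u v) (B≈μ/m u v))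
  where
  open PathMatrices ℝ T tree
  open Matrices ℝ
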